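{- For every $n\geq1$, the presentation $\Omega(n)$ ("$n$-tower of skew frames") is projective within the class of modular lattices, and it can be defined in terms of $n+6$ generators, i.e. it is equivalent within the class of modular lattices to a presentation with $n+6$ generator symbols.
   Context: Lattice terms use $+$ for join and $\cdot$ (or juxtaposition) for meet; $x\leq y$ abbreviates the relation $x=xy$. A presentation consists of a list of generator symbols and a finite set of relations $s=t$ between lattice terms in these symbols; a model of it in a lattice $L$ is an assignment of elements of $L$ to the generator symbols satisfying all relations. A presentation with generator symbols $c_1,\ldots,c_k$ is projective within the class of modular lattices if there are lattice terms $t_1(\bar x),\ldots,t_k(\bar x)$ in $k$ variables such that for every modular lattice $L$ and all $a_1,\ldots,a_k\in L$: (1) $(t_1(\bar a),\ldots,t_k(\bar a))$ is a model of the presentation; (2) if $\bar a$ is a model then $t_i(\bar a)=a_i$ for all $i$. Presentations $\Pi$ (generators $c_1,\ldots,c_k$) and $\Psi$ (generators $d_1,\ldots,d_m$) are equivalent within the class of modular lattices if there are lattice terms $u_1,\ldots,u_m$ in $k$ variables and $v_1,\ldots,v_k$ in $m$ variables such that for every modular lattice $L$: for each model $\bar a$ of $\Pi$ in $L$, $\bar u(\bar a)$ is a model of $\Psi$ and $\bar v(\bar u(\bar a))=\bar a$; for each model $\bar b$ of $\Psi$ in $L$, $\bar v(\bar b)$ is a model of $\Pi$ and $\bar u(\bar v(\bar b))=\bar b$. For lists $\bar x=(x_1,\ldots,x_m)$, $\bar y=(y_1,\ldots,y_m)$, $\bar x\nearrow\bar y$ denotes the conjunction over $i$ of $y_i=x_i+\prod_{j}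 y_j$ and $x_i=y_i\cdot\sum_{j} x_j$. A $2$-frame on symbols $(a_\bot,a_1,a_2,c_{12})$ is given by the relations $a_\bot=a_2a_1$, $a_\bot=a_1c_{12}=a_2c_{12}$, $a_1+a_2=a_1+c_{12}=a_2+c_{12}$ (here the second entry may be any term). $\Delta(n)$: generator symbols $a^k_\bot,a^k_1,a^k_2,c^k_{12}$ ($k=1,\ldots,n$); relations: the $2$-frame relations on $(a^k_\bot,a^k_1,a^k_2,c^k_{12})$ for each $k$, and $(a^k_1+a^k_2,\,a^k_2)\nearrow(a^{k+1}_1,\,a^{k+1}_\bot)$ for $1\leq k<n$. $\Delta(3,n)$: generator symbols of $\Delta(n)$ plus $a^1_3,c^1_{13}$; relations of $\Delta(n)$, $a^1_\bot\leq a^1_3$, $\bigl(\sum s\bigr)a^1_3=a^1_\bot$ with $s$ ranging over the generator symbols of $\Delta(n)$, and the $2$-frame relations on $(a^1_\bot,a^1_1,a^1_3,c^1_{13})$. $\Omega(n)$: generator symbols of $\Delta(3,n)$ plus $a'_4,c'_{14}$; relations of $\Delta(3,n)$, $a^1_\bot\leq a'_4$, $\bigl(\sum s\bigr)a'_4=a^1_\bot$ with $s$ ranging over the generator symbols of $\Delta(3,n)$, and the $2$-frame relations on $(a^1_\bot,\ a^1_1(a'_4+c'_{14}),\ a'_4,\ c'_{14})$. -}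

module Defs where

open import Level using (Level; _⊔_; Setω) renaming (suc to lsuc)
open import Data.Nat using (ℕ; zero; suc; _+_)
open import Data.Fin using (Fin; zero; suc; inject₁)
open import Data.Product using (_×_; _,_)
open import Data.List using (List; []; _∷_; _++_; map; concatMap; foldr)
open import Data.List.Relation.Unary.All using (All)
open import Data.Vec using (Vec; []; _∷_; toList; zip)
open import Data.Vec.Functional as VF using ()
open import Algebra.Lattice.Bundles using (Lattice)

record ModularLattice (c ℓ : Level) : Set (lsuc (c ⊔ ℓ)) where
  field
    lattice : Lattice c ℓ
  open Lattice lattice public
  field
    modular : ∀ x y z → x ≈ x ∧ z → (x ∨ y) ∧ z ≈ x ∨ (y ∧ z)

infixl 6 _⊕_
infixl 7 _·_

data Term (V : Set) : Set where
  var : V → Term V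
  _⊕_ : Term V → Term V → Term V
  _·_ : Term V → Term V → Term V

_[_] : {V W : Set} → Term V → (V → Term W) → Term W
var x [ σ ] = σ x
(s ⊕ t) [ σ ] = (s [ σ ]) ⊕ (t [ σ ])
(s · t) [ σ ] = (s [ σ ]) · (t [ σ ])

module _ {c ℓ : Level} (L : ModularLattice c ℓ) where
  open ModularLattice L

  ⟦_⟧ : {V : Set} → Term V → (V → Carrier) → Carrier
  ⟦ var x ⟧ ρ = ρ x
  ⟦ s ⊕ t ⟧ ρ = ⟦ s ⟧ ρ ∨ ⟦ t ⟧ ρ
  ⟦ s · t ⟧ ρ = ⟦ s ⟧ ρ ∧ ⟦ t ⟧ ρ

Relation : Set → Set
Relation V = Term V × Term V

Presentation : Set → Set
Presentation V = List (Relation V)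

module _ {c ℓ : Level} (L : ModularLattice c ℓ) where
  open ModularLattice L

  IsModel : {V : Set} → Presentation V → (V → Carrier) → Set ℓ
  IsModel Π a = All (λ r → ⟦ L ⟧ (Data.Product.proj₁ r) a ≈ ⟦ L ⟧ (Data.Product.proj₂ r) a) Π
    where import Data.Product

  _≋_ : {V : Set} → (V → Carrier) → (V → Carrier) → Set ℓ
  a ≋ b = ∀ x → a x ≈ b x

_⟪_⟫ : ∀ {c ℓ} {L : ModularLattice c ℓ} {V W : Set} →
       (W → Term V) → (V → ModularLattice.Carrier L) → (W → ModularLattice.Carrier L)
_⟪_⟫ {L = L} t a w = ⟦ L ⟧ (t w) a

record Projective {V : Set} (Π : Presentation V) : Setω where
  field
    t : V → Term V
    model : ∀ {c ℓ} (L : ModularLattice c ℓ) (a : V → ModularLattice.Carrier L) →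
            IsModel L Π (_⟪_⟫ {L = L} t a)
    retract : ∀ {c ℓ} (L : ModularLattice c ℓ) (a : V → ModularLattice.Carrier L) →
              IsModel L Π a → _≋_ L (_⟪_⟫ {L = L} t a) a

record Equivalent {V W : Set} (Π : Presentation V) (Ψ : Presentation W) : Setω where
  field
    u : W → Term V
    v : V → Term W
    u-model : ∀ {c ℓ} (L : ModularLattice c ℓ) (a : V → ModularLattice.Carrier L) →
              IsModel L Π a → IsModel L Ψ (_⟪_⟫ {L = L} u a)
    vu-id   : ∀ {c ℓ} (L : ModularLattice c ℓ) (a : V → ModularLattice.Carrier L) →
              IsModel L Π a → _≋_ L (_⟪_⟫ {L = L} v (_⟪_⟫ {L = L} u a)) a
    v-model : ∀ {c ℓ} (L : ModularLattice c ℓ) (b : W → ModularLattice.Carrier L) →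
              IsModel L Ψ b → IsModel L Π (_⟪_⟫ {L = L} v b)
    uv-id   : ∀ {c ℓ} (L : ModularLattice c ℓ) (b : W → ModularLattice.Carrier L) →
              IsModel L Ψ b → _≋_ L (_⟪_⟫ {L = L} u (_⟪_⟫ {L = L} v b)) b

record EquivalentToPresentationWith {V : Set} (Π : Presentation V) (m : ℕ) : Setω where
  field
    Ψ : Presentation (Fin m)
    equiv : Equivalent Π Ψ

module _ {V : Set} where
  _≤ᵣ_ : Term V → Term V → Relation V
  x ≤ᵣ y = (x , x · y)

  ⨆ : Term V → List (Term V) → Term V
  ⨆ x xs = foldr (λ s acc → acc ⊕ s) x xs

  ⨅ : Term V → List (Term V) → Term V
  ⨅ x xs = foldr (λ s acc → acc · s) x xs

  _↗_ : ∀ {m} → Vec (Term V) (suc m) → Vec (Term V) (suc m) → Presentation V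
  _↗_ (x₀ ∷ xs) (y₀ ∷ ys) =
    map (λ p → (Data.Product.proj₂ p , Data.Product.proj₁ p ⊕ Πy)) ps ++
    map (λ p → (Data.Product.proj₁ p , Data.Product.proj₂ p · Σx)) ps
    where
      import Data.Product
      ps = toList (zip (x₀ ∷ xs) (y₀ ∷ ys))
      Πy = ⨅ y₀ (toList ys)
      Σx = ⨆ x₀ (toList xs)

  2-frame : Term V → Term V → Term V → Term V → Presentation V
  2-frame a⊥ a₁ a₂ c₁₂ =
    (a⊥ , a₂ · a₁) ∷
    (a⊥ , a₁ · c₁₂) ∷ (a₁ · c₁₂ , a₂ · c₁₂) ∷
    (a₁ ⊕ a₂ , a₁ ⊕ c₁₂) ∷ (a₁ ⊕ c₁₂ , a₂ ⊕ c₁₂) ∷ []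

-- Generator symbols of Ω(n), for n = suc m.  The index k : Fin n stands
-- for the superscript k+1 ∈ {1,…,n}.

data GenΩ (n : ℕ) : Set where
  a⊥ a₁ a₂ c₁₂ : Fin n → GenΩ n
  a₃ c₁₃ a₄′ c₁₄′ : GenΩ n

module _ {n : ℕ} where
  private
    g : GenΩ n → Term (GenΩ n)
    g = var

  allFin : (k : ℕ) → List (Fin k)
  allFin zero = []
  allFin (suc k) = zero ∷ map suc (allFin k)

  gensΔ : List (Term (GenΩ n))
  gensΔ = concatMap (λ k → g (a⊥ k) ∷ g (a₁ k) ∷ g (a₂ k) ∷ g (c₁₂ k) ∷ []) (allFin n)

  gensΔ3 : List (Term (GenΩ n))
  gensΔ3 = gensΔ ++ (g a₃ ∷ g c₁₃ ∷ [])

consecutive : (m : ℕ) → List (Fin (suc m) × Fin (suc m))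
consecutive m = map (λ i → (inject₁ i , suc i)) (allFin {n = 0} m)

Δ : (m : ℕ) → Presentation (GenΩ (suc m))
Δ m =
  concatMap (λ k → 2-frame (var (a⊥ k)) (var (a₁ k)) (var (a₂ k)) (var (c₁₂ k)))
            (allFin {n = 0} (suc m)) ++
  concatMap (λ kk → let k = Data.Product.proj₁ kk ; k′ = Data.Product.proj₂ kk in
               (var (a₁ k) ⊕ var (a₂ k) ∷ var (a₂ k) ∷ [])
               ↗ (var (a₁ k′) ∷ var (a⊥ k′) ∷ []))
            (consecutive m)
  where import Data.Product

Δ3 : (m : ℕ) → Presentation (GenΩ (suc m))
Δ3 m =
  Δ m ++
  (var (a⊥ zero) ≤ᵣ var a₃) ∷
  (ΣΔ · var a₃ , var (a⊥ zero)) ∷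
  2-frame (var (a⊥ zero)) (var (a₁ zero)) (var a₃) (var c₁₃)
  where
    ΣΔ = ⨆ (var (a⊥ zero)) (gensΔ {n = suc m})

Ω : (m : ℕ) → Presentation (GenΩ (suc m))
Ω m =
  Δ3 m ++
  (var (a⊥ zero) ≤ᵣ var a₄′) ∷
  (ΣΔ3 · var a₄′ , var (a⊥ zero)) ∷
  2-frame (var (a⊥ zero)) (var (a₁ zero) · (var a₄′ ⊕ var c₁₄′)) (var a₄′) (var c₁₄′)
  where
    ΣΔ3 = ⨆ (var (a⊥ zero)) (gensΔ3 {n = suc m})

record _×ω_ (A B : Setω) : Setω where
  constructor _,ω_
  field
    fst : A
    snd : B

{-# OPTIONS --safe #-}

-- A construction on tuples that is uniform in the lattice operations and that fixes every model
-- gives projectivity: run it on the variables, in the free modular lattice to see that its terms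
-- yield models, and in the lattice presented by Ω(n) to see that they fix models.
--
-- A tower is built from the bottom.  In a tower all intervals [⊥ᵏ,a₁ᵏ] transpose down to
-- [⊥¹,a₁¹], so a subinterval [p,q] of [⊥¹,a₁¹] cuts out a subframe on every floor, and these again
-- form a tower.  A new floor is the median frame of three elements above a₂ᵏ, which makes the
-- lower floors shrink to the matching [p,q].  To make an element e independent of the tower with
-- join T, join all entries with w = T e and run the construction again: everything stays in
-- [w,T], so the new bottom is ≥ w, while the new T is not larger.  Two independent elements e, k
-- moreover get ek ≤ ⊥ by joining everything with ek.
--
-- For the number of generators: in a tower ⊥ᵏ = cᵏcᵏ⁺¹, a₁ᵏ = a₁¹ + ⊥ᵏ, a₂ᵏ = cᵏ⁺¹(a₁¹ + cᵏ) for
-- k < n, and the same holds for k = n with a₂ⁿ in place of cⁿ⁺¹.  So a₁¹, c¹, …, cⁿ, a₂ⁿ, a₃, c₁₃,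
-- a₄′, c₁₄′ suffice.

module Submission where

open import Defs
open import Level using (Level; Setω; 0ℓ)
open import Data.Nat using (ℕ; zero; suc; _+_)
open import Data.Fin using (Fin; zero; suc; inject₁; fromℕ; _↑ˡ_; _↑ʳ_; splitAt)
open import Data.Fin.Properties using (splitAt-↑ˡ; splitAt-↑ʳ)
open import Data.Fin.Induction using (<-weakInduction; >-weakInduction)
open import Data.Fin.Patterns using (0F; 1F; 2F; 3F; 4F; 5F)
open import Data.List using (List; []; _∷_; _++_; map; concatMap)
open import Data.List.Membership.Propositional using (_∈_)
open import Data.List.Relation.Unary.All as All using (All; []; _∷_)
open import Data.List.Relation.Unary.All.Properties using (++⁺; ++⁻; map⁺; map⁻; concat⁺; concat⁻)
open import Data.Product using (_×_; _,_; proj₁; proj₂)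
open import Data.Sum using ([_,_]′)
open import Data.Vec using ([]; _∷_)
open import Function using (_∘_)
open import Relation.Binary.Bundles using (Poset)
open import Relation.Binary.PropositionalEquality using (_≡_; cong; cong₂; subst; subst₂)
  renaming (refl to ≡-refl; sym to ≡-sym; trans to ≡-trans)
import Algebra.Lattice.Properties.Lattice as LatticeProperties
import Relation.Binary.Lattice.Structures as OrderLattice

private variable
  c ℓ : Level

-- Sequences extended at the end.

snoc : {A : Set c} {n : ℕ} → (Fin n → A) → A → Fin (suc n) → A
snoc {n = zero}  f x zero    = x
snoc {n = suc n} f x zero    = f zero
snoc {n = suc n} f x (suc i) = snoc (f ∘ suc) x i

snoc-elim : {A : Set c} {n : ℕ} (P : Fin (suc n) → A → Set ℓ) {f : Fin n → A} {x : A} →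
            (∀ i → P (inject₁ i) (f i)) → P (fromℕ n) x → ∀ i → P i (snoc f x i)
snoc-elim {n = zero}  P p q zero    = q
snoc-elim {n = suc n} P p q zero    = p zero
snoc-elim {n = suc n} P p q (suc i) = snoc-elim (P ∘ suc) (p ∘ suc) q i

snoc-consecutive : {A : Set c} {n : ℕ} (Q : A → A → Set ℓ) {f : Fin (suc n) → A} {x : A} →
                   (∀ i → Q (f (inject₁ i)) (f (suc i))) → Q (f (fromℕ n)) x →
                   ∀ i → Q (snoc f x (inject₁ i)) (snoc f x (suc i))
snoc-consecutive {n = zero}  Q p q zero    = q
snoc-consecutive {n = suc n} Q p q zero    = p zero
snoc-consecutive {n = suc n} Q p q (suc i) = snoc-consecutive Q (p ∘ suc) q i

-- The construction on tuples.

-- The entries (a⊥ᵏ, a₁ᵏ, a₂ᵏ, c₁₂ᵏ) of one floor; d is used for c₁₂.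
record Floor (C : Set c) : Set c where
  constructor floor
  field
    o a b d : C

open Floor

-- Carries no laws, so that terms with `_⊕_` and `_·_` qualify as well as the elements of a lattice.
record Ops (C : Set c) : Set c where
  infixr 6 _∨_
  infixr 7 _∧_
  field
    _∨_ _∧_ : C → C → C

module Construction {c : Level} {C : Set c} (O : Ops C) where
  open Ops O

  top : Floor C → C
  top l = a l ∨ b l

  lower upper : C → C → C → C
  lower x y z = x ∧ y ∨ x ∧ z ∨ y ∧ z
  upper x y z = (x ∨ y) ∧ (x ∨ z) ∧ (y ∨ z)

  -- In a modular lattice this is the image of the diamond in the free modular lattice on three
  -- generators, whose bottom and top are the lower and upper medians `u` and `v`.
  median : C → C → C → Floor C
  median x y z = floor u (x ∧ v ∨ u) (y ∧ v ∨ u) (z ∧ v ∨ u)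
    where
      u = lower x y z
      v = upper x y z

  -- The subframe cut out by a subinterval [p,q] of [⊥,a₁], with everything joined with p.
  shrink : C → C → Floor C → Floor C
  shrink p q (floor o a b d) =
    floor (p ∨ b ∧ (p ∨ d)) (q ∨ b ∧ (p ∨ d)) (p ∨ b ∧ (q ∨ d)) (p ∨ d ∧ (q ∨ b))

  raise : C → Floor C → Floor C
  raise w (floor o a b d) = floor (o ∨ w) (a ∨ w) (b ∨ w) (d ∨ w)

  next : Floor C → Floor C → Floor C
  next l x = median (top l ∨ w) (b x ∨ w) (d x ∨ w)
    -- On consecutive floors of a tower this is the bottom of `x`; in general it forces the new
    -- bottom above `b l`.
    where w = b x ∧ d x ∨ b l

  -- The new floor may capture only part of the old top, so the floors below are cut down to its
  -- trace on the first floor. Over a tower the upper end may be taken with `top l`, since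
  -- `a (f zero)` meets `top l` inside `a l`.
  extend : {m : ℕ} → (Fin (suc m) → Floor C) → Floor C → Fin (suc (suc m)) → Floor C
  extend {m} f x = snoc (shrink (a (f zero) ∧ o l) (a (f zero) ∧ top l) ∘ f) l
    where l = next (f (fromℕ m)) x

  tower : (m : ℕ) → (Fin (suc m) → Floor C) → Fin (suc m) → Floor C
  tower zero    f _ = median (a (f zero)) (b (f zero)) (d (f zero))
  tower (suc m) f   = extend (tower m (f ∘ inject₁)) (f (fromℕ (suc m)))

  -- e and k are the entries a₃ and c₁₃.
  record Tower₃ (m : ℕ) : Set c where
    constructor tower₃
    field
      floors : Fin (suc m) → Floor C
      e k    : C

  open Tower₃ public

  raise₃ : {m : ℕ} → C → Tower₃ m → Tower₃ m
  raise₃ w (tower₃ f e k) = tower₃ (raise w ∘ f) (e ∨ w) (k ∨ w)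

  height : {m : ℕ} → (Fin (suc m) → Floor C) → C
  height {m} f = top (f (fromℕ m))

  -- Over a tower, the first join makes `e` and `k` independent of `f₁`. The second join puts
  -- `e₁ ∧ k₁` into the bottom, so that the final median has the same bottom as `f₂`, and only upper
  -- ends remain to be cut.
  attach₃ : {m : ℕ} → (Fin (suc m) → Floor C) → C → C → Tower₃ m
  attach₃ {m} f e k = tower₃ (shrink (o (f₂ zero)) (a (f₂ zero) ∧ top l) ∘ f₂) (b l) (d l)
    where
      f₁ = tower m (raise (height f ∧ e ∨ height f ∧ k) ∘ f)
      e₁ = e ∨ o (f₁ zero)
      k₁ = k ∨ o (f₁ zero)
      f₂ = raise (e₁ ∧ k₁) ∘ f₁
      l  = median (a (f₂ zero)) e₁ k₁

  opaque
    retract₃ : {m : ℕ} → Tower₃ m → Tower₃ m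
    retract₃ {m} (tower₃ f e k) = attach₃ (tower m f) e k

  height₃ : {m : ℕ} → Tower₃ m → C
  height₃ M = height (floors M) ∨ e M

  -- g and h are the entries a₄′ and c₁₄′.
  record Tower₄ (m : ℕ) : Set c where
    constructor tower₄
    field
      base  : Tower₃ m
      g h   : C

  open Tower₄ public

  -- The frame relations for `g` and `h` involve only a part of `a₁` on the first floor. So the
  -- tower is merely raised, and it is `g₁` and `h₁` that are cut down, along the part `r`.
  adjoin₄ : {m : ℕ} → Tower₃ m → C → C → Tower₄ m
  adjoin₄ M g h = tower₄ (raise₃ (g₁ ∧ h₁) M) (g₁ ∧ (r ∨ h₁)) (h₁ ∧ (r ∨ g₁))
    where
      g₁ = g ∨ o (floors M zero)
      h₁ = h ∨ o (floors M zero)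
      r  = a (raise (g₁ ∧ h₁) (floors M zero)) ∧ (g₁ ∨ h₁)

  -- Joining a tower with an arbitrary element can destroy it; `retract₃` rebuilds one inside the
  -- same interval.
  attach₄ : {m : ℕ} → Tower₃ m → C → C → Tower₄ m
  attach₄ M g h = adjoin₄ (retract₃ (raise₃ (height₃ M ∧ g ∨ height₃ M ∧ h) M)) g h

  retract₄ : {m : ℕ} → Tower₄ m → Tower₄ m
  retract₄ (tower₄ M g h) = attach₄ (retract₃ M) g h

  fromAssignment : {m : ℕ} → (GenΩ (suc m) → C) → Tower₄ m
  fromAssignment ρ =
    tower₄ (tower₃ (λ i → floor (ρ (a⊥ i)) (ρ (a₁ i)) (ρ (a₂ i)) (ρ (c₁₂ i))) (ρ a₃) (ρ c₁₃)) (ρ a₄′) (ρ c₁₄′)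

  toAssignment : {m : ℕ} → Tower₄ m → GenΩ (suc m) → C
  toAssignment (tower₄ (tower₃ f e k) g h) (a⊥ i)  = o (f i)
  toAssignment (tower₄ (tower₃ f e k) g h) (a₁ i)  = a (f i)
  toAssignment (tower₄ (tower₃ f e k) g h) (a₂ i)  = b (f i)
  toAssignment (tower₄ (tower₃ f e k) g h) (c₁₂ i) = d (f i)
  toAssignment (tower₄ (tower₃ f e k) g h) a₃      = e
  toAssignment (tower₄ (tower₃ f e k) g h) c₁₃     = k
  toAssignment (tower₄ (tower₃ f e k) g h) a₄′     = g
  toAssignment (tower₄ (tower₃ f e k) g h) c₁₄′    = h

  retraction : {m : ℕ} → (GenΩ (suc m) → C) → GenΩ (suc m) → C
  retraction ρ = toAssignment (retract₄ (fromAssignment ρ))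

-- Order reasoning in a modular lattice.

module Modular {c ℓ : Level} (L : ModularLattice c ℓ) where
  open ModularLattice L public
  open LatticeProperties lattice using (poset; ∨-∧-isOrderTheoreticLattice)
  open Poset poset public using (_≤_)
  open OrderLattice.IsLattice ∨-∧-isOrderTheoreticLattice public
    using (∨-least; ∧-greatest; x≤x∨y; y≤x∨y; x∧y≤x; x∧y≤y; antisym)
    renaming (refl to ≤-refl; trans to ≤-trans; reflexive to ≤-reflexive)

  operations : Ops Carrier
  operations = record { _∨_ = _∨_ ; _∧_ = _∧_ }

  open Construction operations public

  private variable
    x y z t r x′ y′ : Carrier

  ∨ˡ : t ≤ x → t ≤ x ∨ y
  ∨ˡ p = ≤-trans p (x≤x∨y _ _)

  ∨ʳ : t ≤ y → t ≤ x ∨ y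
  ∨ʳ p = ≤-trans p (y≤x∨y _ _)

  ∧ˡ : x ≤ t → x ∧ y ≤ t
  ∧ˡ p = ≤-trans (x∧y≤x _ _) p

  ∧ʳ : y ≤ t → x ∧ y ≤ t
  ∧ʳ p = ≤-trans (x∧y≤y _ _) p

  ∨-mono : x ≤ x′ → y ≤ y′ → x ∨ y ≤ x′ ∨ y′
  ∨-mono p q = ∨-least (∨ˡ p) (∨ʳ q)

  ∧-mono : x ≤ x′ → y ≤ y′ → x ∧ y ≤ x′ ∧ y′
  ∧-mono p q = ∧-greatest (∧ˡ p) (∧ʳ q)

  ≤-resp : x ≈ x′ → y ≈ y′ → x ≤ y → x′ ≤ y′
  ≤-resp p q x≤y = ≤-trans (≤-reflexive (sym p)) (≤-trans x≤y (≤-reflexive q))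

  ∨-swap : x ∨ y ≤ y ∨ x
  ∨-swap = ∨-least (∨ʳ ≤-refl) (∨ˡ ≤-refl)

  ∧-swap : x ∧ y ≤ y ∧ x
  ∧-swap = ∧-greatest (∧ʳ ≤-refl) (∧ˡ ≤-refl)

  ∨-absorb : y ≤ x → x ∨ y ≈ x
  ∨-absorb y≤x = antisym (∨-least ≤-refl y≤x) (∨ˡ ≤-refl)

  -- By modularity `t` lies below `x ∨ (y ∧ z)`, so it is enough to bound the two joinands. Nearly
  -- every application of the modular law below takes this form.
  modular-≤ : x ≤ z → t ≤ x ∨ y → t ≤ z → x ≤ r → y ∧ z ≤ r → t ≤ r
  modular-≤ x≤z t≤xy t≤z x≤r yz≤r =
    ≤-trans (∧-greatest t≤xy t≤z) (≤-trans (≤-reflexive (modular _ _ _ x≤z)) (∨-least x≤r yz≤r))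

  modular-≤ʳ : x ≤ z → t ≤ y ∨ x → t ≤ z → x ≤ r → y ∧ z ≤ r → t ≤ r
  modular-≤ʳ x≤z t≤yx = modular-≤ x≤z (≤-trans t≤yx ∨-swap)

  -- Frames and medians.

  record IsFrame (l : Floor Carrier) : Set ℓ where
    constructor isFrame
    field
      ab≤o : a l ∧ b l ≤ o l
      ad≤o : a l ∧ d l ≤ o l
      bd≤o : b l ∧ d l ≤ o l
      o≤a  : o l ≤ a l
      o≤b  : o l ≤ b l
      o≤d  : o l ≤ d l
      a≤b∨d : a l ≤ b l ∨ d l
      b≤a∨d : b l ≤ a l ∨ d l
      d≤a∨b : d l ≤ a l ∨ b l

  open IsFrame public

  record _≈ᶠ_ (l l′ : Floor Carrier) : Set ℓ where
    constructor floor-≈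
    field
      o-≈ : o l ≈ o l′
      a-≈ : a l ≈ a l′
      b-≈ : b l ≈ b l′
      d-≈ : d l ≈ d l′

  open _≈ᶠ_ public

  ≈ᶠ-refl : ∀ {l} → l ≈ᶠ l
  ≈ᶠ-refl = floor-≈ refl refl refl refl

  ≈ᶠ-sym : ∀ {l l′} → l ≈ᶠ l′ → l′ ≈ᶠ l
  ≈ᶠ-sym (floor-≈ p q r s) = floor-≈ (sym p) (sym q) (sym r) (sym s)

  ≈ᶠ-trans : ∀ {l l′ l″} → l ≈ᶠ l′ → l′ ≈ᶠ l″ → l ≈ᶠ l″
  ≈ᶠ-trans (floor-≈ p q r s) (floor-≈ p′ q′ r′ s′) = floor-≈ (trans p p′) (trans q q′) (trans r r′) (trans s s′)

  isFrame-resp : ∀ {l l′} → l ≈ᶠ l′ → IsFrame l → IsFrame l′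
  isFrame-resp (floor-≈ o≈ a≈ b≈ d≈) F = isFrame
    (≤-resp (∧-cong a≈ b≈) o≈ (ab≤o F)) (≤-resp (∧-cong a≈ d≈) o≈ (ad≤o F)) (≤-resp (∧-cong b≈ d≈) o≈ (bd≤o F))
    (≤-resp o≈ a≈ (o≤a F)) (≤-resp o≈ b≈ (o≤b F)) (≤-resp o≈ d≈ (o≤d F))
    (≤-resp a≈ (∨-cong b≈ d≈) (a≤b∨d F)) (≤-resp b≈ (∨-cong a≈ d≈) (b≤a∨d F))
    (≤-resp d≈ (∨-cong a≈ b≈) (d≤a∨b F))

  -- A first use of modularity splits off `u` and leaves something below `x ∧ (y ∨ (x ∧ z))`; a
  -- second one turns this into `(x ∧ z) ∨ (y ∧ x)`. Permuting the arguments covers all three pairs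
  -- of a median.
  median-∧ : ∀ {u v x y z} → x ∧ z ≤ u → y ∧ x ≤ u → u ≤ y ∨ (x ∧ z) →
             (x ∧ v ∨ u) ∧ (y ∧ v ∨ u) ≤ u
  median-∧ xz≤u yx≤u u≤ =
    modular-≤ʳ (∨ʳ ≤-refl) (∧ˡ ≤-refl) (∧ʳ ≤-refl) ≤-refl
      (modular-≤ʳ (∧ˡ ≤-refl) (∧ʳ (∨-least (∨ˡ (∧ˡ ≤-refl)) u≤)) (∧ˡ (∧ˡ ≤-refl)) xz≤u yx≤u)

  -- Dual to `median-∧`: `v` is below `(x ∨ y) ∧ (x ∨ z)`, which is `x ∨ y ∧ (x ∨ z)`, and the
  -- second joinand already lies below `v`, so meeting with `v` distributes.
  median-∨ : ∀ {v x y z} → v ≤ x ∨ y → v ≤ x ∨ z → y ∧ (x ∨ z) ≤ v →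
             v ≤ x ∧ v ∨ y ∧ v
  median-∨ {v} {x} {y} {z} v≤xy v≤xz q≤v =
    modular-≤ʳ q≤v v≤ ≤-refl (∨ʳ (∧-greatest (∧ˡ ≤-refl) q≤v)) (∨ˡ ≤-refl)
    where
      v≤ : v ≤ x ∨ y ∧ (x ∨ z)
      v≤ = modular-≤ (∨ˡ ≤-refl) v≤xy v≤xz (∨ˡ ≤-refl) (∨ʳ ≤-refl)

  lower≤upper : lower x y z ≤ upper x y z
  lower≤upper = ∨-least
    (∧-greatest (∧ˡ (∨ˡ ≤-refl)) (∧-greatest (∧ˡ (∨ˡ ≤-refl)) (∧ʳ (∨ˡ ≤-refl))))
    (∨-least (∧-greatest (∧ˡ (∨ˡ ≤-refl)) (∧-greatest (∧ˡ (∨ˡ ≤-refl)) (∧ʳ (∨ʳ ≤-refl))))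
             (∧-greatest (∧ˡ (∨ʳ ≤-refl)) (∧-greatest (∧ʳ (∨ʳ ≤-refl)) (∧ˡ (∨ˡ ≤-refl)))))

  upper≤median-top : upper x y z ≤ top (median x y z)
  upper≤median-top = ≤-trans
    (median-∨ (∧ˡ ≤-refl) (∧ʳ (∧ˡ ≤-refl))
      (∧-greatest (∧ˡ (∨ʳ ≤-refl)) (∧-greatest (∧ʳ ≤-refl) (∧ˡ (∨ˡ ≤-refl)))))
    (∨-mono (∨ˡ ≤-refl) (∨ˡ ≤-refl))

  median-isFrame : ∀ x y z → IsFrame (median x y z)
  median-isFrame x y z = record
    { ab≤o = median-∧ xz≤u (≤-trans ∧-swap xy≤u)
               (∨-least (∨ˡ (∧ʳ ≤-refl)) (∨-least (∨ʳ ≤-refl) (∨ˡ (∧ˡ ≤-refl))))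
    ; ad≤o = median-∧ xy≤u (≤-trans ∧-swap xz≤u)
               (∨-least (∨ʳ ≤-refl) (∨-least (∨ˡ (∧ʳ ≤-refl)) (∨ˡ (∧ʳ ≤-refl))))
    ; bd≤o = median-∧ (≤-trans ∧-swap xy≤u) (≤-trans ∧-swap yz≤u)
               (∨-least (∨ʳ ∧-swap) (∨-least (∨ˡ (∧ʳ ≤-refl)) (∨ˡ (∧ʳ ≤-refl))))
    ; o≤a = ∨ʳ ≤-refl
    ; o≤b = ∨ʳ ≤-refl
    ; o≤d = ∨ʳ ≤-refl
    ; a≤b∨d = ∨-least (∧ʳ (≤-trans
               (median-∨ v≤yz (≤-trans v≤xy ∨-swap)
                  (∧-greatest (∧ʳ ∨-swap) (∧-greatest (∧ˡ (∨ʳ ≤-refl)) (∧ˡ (∨ʳ ≤-refl)))))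
               widen)) (∨ˡ (∨ʳ ≤-refl))
    ; b≤a∨d = ∨-least (∧ʳ (≤-trans
               (median-∨ v≤xz v≤xy
                  (∧-greatest (∧ʳ ≤-refl) (∧-greatest (∧ˡ (∨ʳ ≤-refl)) (∧ˡ (∨ʳ ≤-refl)))))
               widen)) (∨ˡ (∨ʳ ≤-refl))
    ; d≤a∨b = ∨-least (∧ʳ upper≤median-top) (∨ˡ (∨ʳ ≤-refl))
    }
    where
      u = lower x y z
      v = upper x y z
      xy≤u : x ∧ y ≤ u
      xy≤u = ∨ˡ ≤-refl
      xz≤u : x ∧ z ≤ u
      xz≤u = ∨ʳ (∨ˡ ≤-refl)
      yz≤u : y ∧ z ≤ u
      yz≤u = ∨ʳ (∨ʳ ≤-refl)
      v≤xy : v ≤ x ∨ y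
      v≤xy = ∧ˡ ≤-refl
      v≤xz : v ≤ x ∨ z
      v≤xz = ∧ʳ (∧ˡ ≤-refl)
      v≤yz : v ≤ y ∨ z
      v≤yz = ∧ʳ (∧ʳ ≤-refl)
      widen : ∀ {r s u} → r ∨ s ≤ (r ∨ u) ∨ (s ∨ u)
      widen = ∨-mono (∨ˡ ≤-refl) (∨ˡ ≤-refl)

  median-id : ∀ {l} → IsFrame l → median (a l) (b l) (d l) ≈ᶠ l
  median-id {l} F = record
    { o-≈ = antisym u≤o o≤u
    ; a-≈ = antisym (∨-least (∧ˡ ≤-refl) (≤-trans u≤o (o≤a F)))
                    (∨ˡ (∧-greatest ≤-refl (∧-greatest (∨ˡ ≤-refl) (∧-greatest (∨ˡ ≤-refl) (a≤b∨d F)))))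
    ; b-≈ = antisym (∨-least (∧ˡ ≤-refl) (≤-trans u≤o (o≤b F)))
                    (∨ˡ (∧-greatest ≤-refl (∧-greatest (∨ʳ ≤-refl) (∧-greatest (b≤a∨d F) (∨ˡ ≤-refl)))))
    ; d-≈ = antisym (∨-least (∧ˡ ≤-refl) (≤-trans u≤o (o≤d F)))
                    (∨ˡ (∧-greatest ≤-refl (∧-greatest (d≤a∨b F) (∧-greatest (∨ʳ ≤-refl) (∨ʳ ≤-refl)))))
    }
    where
      u≤o : lower (a l) (b l) (d l) ≤ o l
      u≤o = ∨-least (ab≤o F) (∨-least (ad≤o F) (bd≤o F))
      o≤u : o l ≤ lower (a l) (b l) (d l)
      o≤u = ∨ˡ (∧-greatest (o≤a F) (o≤b F))

  -- Subframes and links between floors.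

  -- Two uses of modularity, one for each joinand. It serves to show that cutting `y` and `z` down
  -- to the parts that `x` sees does not lose `x`.
  split-≤ : x ≤ y ∨ z → x ≤ y ∧ (x ∨ z) ∨ z ∧ (x ∨ y)
  split-≤ {x} {y} {z} x≤yz =
    modular-≤ʳ (∧ˡ (∨ʳ ≤-refl)) x≤ (∨ˡ ≤-refl) (∨ˡ ≤-refl) (∨ʳ ≤-refl)
    where
      x≤ : x ≤ z ∨ y ∧ (x ∨ z)
      x≤ = modular-≤ (∨ʳ ≤-refl) (≤-trans x≤yz ∨-swap) (∨ˡ ≤-refl) (∨ˡ ≤-refl) (∨ʳ ≤-refl)

  -- The element `b ∧ (p ∨ d)` is the image of `p` under the perspectivity from `a` to `b` with axis
  -- `d`. This image lies above `o`, so `p` and `q` taken from the first floor can be used unchanged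
  -- on every floor.
  shrink-isFrame : ∀ {p q l} → p ≤ q → q ≤ a l → IsFrame l → IsFrame (shrink p q l)
  shrink-isFrame {p} {q} {floor o a b d} p≤q q≤a F = record
    { ab≤o = modular-≤ʳ (∨ʳ p′≤q′) (∧ˡ ≤-refl) (∧ʳ ≤-refl) (∨ʳ ≤-refl)
               (modular-≤ p≤q (∧ʳ ≤-refl) (∧ˡ ≤-refl) (∨ˡ ≤-refl)
                 (≤-trans (∧-greatest (∧ʳ q≤a) (∧ˡ (∧ˡ ≤-refl))) ab≤))
    ; ad≤o = modular-≤ʳ (∧ʳ ≤-refl) (∧ˡ ≤-refl) (∧ʳ (∨-mono ≤-refl (∧ˡ ≤-refl))) (∨ʳ ≤-refl)
               (modular-≤ p≤q (∧ʳ ≤-refl) (∧ˡ ≤-refl) (∨ˡ ≤-refl)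
                 (≤-trans (∧-greatest (∧ʳ q≤a) (∧ˡ ≤-refl)) ad≤))
    ; bd≤o = modular-≤ (∨ˡ ≤-refl) (∧ˡ ≤-refl) (∧ʳ (∨-mono ≤-refl (∧ˡ ≤-refl))) (∨ˡ ≤-refl)
               (∨ʳ (∧-mono (∧ˡ ≤-refl) ≤-refl))
    ; o≤a = ∨-mono p≤q ≤-refl
    ; o≤b = ∨-mono ≤-refl p′≤q′
    ; o≤d = ∨-least (∨ˡ ≤-refl)
              (modular-≤ (∨ˡ p≤q) (∧ʳ ≤-refl) (∧ˡ (∨ʳ ≤-refl)) (∨ˡ ≤-refl) (∨ʳ ≤-refl))
    ; a≤b∨d = ∨-least
              (≤-trans (split-≤ (≤-trans q≤a (a≤b∨d F))) (∨-mono (∨ʳ ≤-refl) (∨ʳ ≤-refl)))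
              (∨ˡ (∨ʳ p′≤q′))
    ; b≤a∨d = ∨-least (∨ˡ (∨ˡ p≤q))
              (modular-≤ (∨ˡ ≤-refl) (∧ʳ ≤-refl) (∧ˡ (∨ʳ ≤-refl)) (∨ˡ (∨ˡ ≤-refl)) (∨ʳ (∨ʳ ≤-refl)))
    ; d≤a∨b = ∨-least (∨ˡ (∨ˡ p≤q))
              (modular-≤ (∨ˡ ≤-refl) (∧ʳ ≤-refl) (∧ˡ (∨ʳ ≤-refl)) (∨ˡ (∨ˡ ≤-refl)) (∨ʳ (∨ʳ ≤-refl)))
    }
    where
      p′≤q′ : b ∧ (p ∨ d) ≤ b ∧ (q ∨ d)
      p′≤q′ = ∧-mono ≤-refl (∨-mono p≤q ≤-refl)
      o≤p′ : o ≤ b ∧ (p ∨ d)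
      o≤p′ = ∧-greatest (o≤b F) (∨ʳ (o≤d F))
      ab≤ : a ∧ b ≤ p ∨ b ∧ (p ∨ d)
      ab≤ = ∨ʳ (≤-trans (ab≤o F) o≤p′)
      ad≤ : a ∧ d ≤ p ∨ b ∧ (p ∨ d)
      ad≤ = ∨ʳ (≤-trans (ad≤o F) o≤p′)

  shrink-id : ∀ {p q l} → p ≤ o l → q ≤ a l → a l ≤ q ∨ o l → IsFrame l → shrink p q l ≈ᶠ l
  shrink-id {p} {q} {floor o a b d} p≤o q≤a a≤q∨o F = record
    { o-≈ = antisym (∨-least p≤o p′≤o) (∨ʳ o≤p′)
    ; a-≈ = antisym (∨-least q≤a (≤-trans p′≤o (o≤a F))) (≤-trans a≤q∨o (∨-mono ≤-refl o≤p′))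
    ; b-≈ = antisym (∨-least (≤-trans p≤o (o≤b F)) (∧ˡ ≤-refl))
                    (∨ʳ (∧-greatest ≤-refl (≤-trans (b≤a∨d F)
                      (∨-least (≤-trans a≤q∨o (∨-mono ≤-refl (o≤d F))) (∨ʳ ≤-refl)))))
    ; d-≈ = antisym (∨-least (≤-trans p≤o (o≤d F)) (∧ˡ ≤-refl))
                    (∨ʳ (∧-greatest ≤-refl (≤-trans (d≤a∨b F)
                      (∨-least (≤-trans a≤q∨o (∨-mono ≤-refl (o≤b F))) (∨ʳ ≤-refl)))))
    }
    where
      p′≤o : b ∧ (p ∨ d) ≤ o
      p′≤o = ≤-trans (∧-mono ≤-refl (∨-least (≤-trans p≤o (o≤d F)) ≤-refl)) (bd≤o F)
      o≤p′ : o ≤ b ∧ (p ∨ d)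
      o≤p′ = ∧-greatest (o≤b F) (∨ʳ (o≤d F))

  shrink-top : ∀ {p q l} → p ≤ a l → q ≤ a l → top (shrink p q l) ≤ top l
  shrink-top p≤a q≤a = ∨-least (∨-mono q≤a (∧ˡ ≤-refl)) (∨-mono p≤a (∧ˡ ≤-refl))

  -- The relation `↗` between consecutive floors as inequalities: the interval from `b l` to `top l`
  -- transposes up to the one from `o l′` to `a l′`.
  record IsLinked (l l′ : Floor Carrier) : Set ℓ where
    constructor isLinked
    field
      b≤o     : b l ≤ o l′
      top≤a   : top l ≤ a l′
      a≤top∨o : a l′ ≤ top l ∨ o l′
      top∧o≤b : top l ∧ o l′ ≤ b l

  open IsLinked public

  top-cong : ∀ {l l′} → l ≈ᶠ l′ → top l ≈ top l′
  top-cong E = ∨-cong (a-≈ E) (b-≈ E)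

  isLinked-resp : ∀ {l k l′ k′} → l ≈ᶠ k → l′ ≈ᶠ k′ → IsLinked l l′ → IsLinked k k′
  isLinked-resp E E′ K = isLinked
    (≤-resp (b-≈ E) (o-≈ E′) (b≤o K)) (≤-resp (top-cong E) (a-≈ E′) (top≤a K))
    (≤-resp (a-≈ E′) (∨-cong (top-cong E) (o-≈ E′)) (a≤top∨o K))
    (≤-resp (∧-cong (top-cong E) (o-≈ E′)) (b-≈ E) (top∧o≤b K))

  -- Whatever lies below `b l` is absorbed by the new bottom of the upper floor. For `top∧o≤b`
  -- modularity therefore leaves only `q ∧ b l′`, which is below `x ∧ b l′` and hence below `p`.
  shrink-isLinked : ∀ {x p q l l′} → p ≤ q → q ≤ x → x ∧ b l′ ≤ p → IsFrame l′ →
                    IsLinked l l′ → IsLinked (shrink p q l) (shrink p q l′)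
  shrink-isLinked {x} {p} {q} {l} {l′} p≤q q≤x xb≤p F′ K = record
    { b≤o     = ∨-mono ≤-refl (≤-trans (∧ˡ ≤-refl) b≤p′)
    ; top≤a   = ∨-least (∨-mono ≤-refl (≤-trans (∧ˡ ≤-refl) b≤p′)) (∨-mono p≤q (≤-trans (∧ˡ ≤-refl) b≤p′))
    ; a≤top∨o = ∨-least (∨ˡ (∨ˡ (∨ˡ ≤-refl))) (∨ʳ (∨ʳ ≤-refl))
    ; top∧o≤b = modular-≤ʳ (≤-trans (∧ˡ ≤-refl) (∨ʳ b≤p′)) (∧ˡ top≤) (∧ʳ ≤-refl) (∨ʳ ≤-refl)
                  (modular-≤ p≤q (∧ʳ ≤-refl) (∧ˡ ≤-refl) (∨ˡ ≤-refl)
                    (∨ˡ (≤-trans (∧-greatest (∧ʳ q≤x) (∧ˡ (∧ˡ ≤-refl))) xb≤p)))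
    }
    where
      b≤p′ : b l ≤ b l′ ∧ (p ∨ d l′)
      b≤p′ = ≤-trans (b≤o K) (∧-greatest (o≤b F′) (∨ʳ (o≤d F′)))
      top≤ : top (shrink p q l) ≤ q ∨ b l ∧ (q ∨ d l)
      top≤ = ∨-least (∨-mono ≤-refl (∧-mono ≤-refl (∨-mono p≤q ≤-refl))) (∨-mono p≤q ≤-refl)

  -- Joining a frame with a fixed element.

  -- Modularity splits off `u` and leaves `x ∧ (y ∨ u)`. As `x ≤ T`, this is below `T ∧ (y ∨ u)`,
  -- which is `y ∨ (u ∧ T)` and collapses to `y`. Thus joining with `u` creates no new meets beyond
  -- `u` itself.
  raise-∧ : ∀ {T u v} → x ≤ T → y ≤ T → v ≤ y → T ∧ u ≤ v → x ∧ y ≤ r → u ≤ r → (x ∨ u) ∧ (y ∨ u) ≤ r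
  raise-∧ {x} {y} {u = u} x≤T y≤T v≤y Tu≤v xy≤r u≤r =
    modular-≤ʳ (∨ʳ ≤-refl) (∧ˡ ≤-refl) (∧ʳ ≤-refl) u≤r (≤-trans (∧-greatest (∧ˡ ≤-refl) s≤y) xy≤r)
    where
      s≤y : x ∧ (y ∨ u) ≤ y
      s≤y = modular-≤ y≤T (∧ʳ ≤-refl) (∧ˡ x≤T) ≤-refl (≤-trans ∧-swap (≤-trans Tu≤v v≤y))

  ∨-raise : ∀ {u} → x ≤ y ∨ z → x ∨ u ≤ (y ∨ u) ∨ (z ∨ u)
  ∨-raise x≤ = ∨-least (≤-trans x≤ (∨-mono (∨ˡ ≤-refl) (∨ˡ ≤-refl))) (∨ˡ (∨ʳ ≤-refl))

  module _ {T u v : Carrier} (Tu≤v : T ∧ u ≤ v) where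

    raise-isFrame : ∀ {l} → v ≤ o l → a l ≤ T → b l ≤ T → d l ≤ T → IsFrame l → IsFrame (raise u l)
    raise-isFrame v≤o a≤T b≤T d≤T F = record
      { ab≤o = raise-∧ a≤T b≤T (≤-trans v≤o (o≤b F)) Tu≤v (∨ˡ (ab≤o F)) (∨ʳ ≤-refl)
      ; ad≤o = raise-∧ a≤T d≤T (≤-trans v≤o (o≤d F)) Tu≤v (∨ˡ (ad≤o F)) (∨ʳ ≤-refl)
      ; bd≤o = raise-∧ b≤T d≤T (≤-trans v≤o (o≤d F)) Tu≤v (∨ˡ (bd≤o F)) (∨ʳ ≤-refl)
      ; o≤a = ∨-mono (o≤a F) ≤-refl
      ; o≤b = ∨-mono (o≤b F) ≤-refl
      ; o≤d = ∨-mono (o≤d F) ≤-refl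
      ; a≤b∨d = ∨-raise (a≤b∨d F)
      ; b≤a∨d = ∨-raise (b≤a∨d F)
      ; d≤a∨b = ∨-raise (d≤a∨b F)
      }

    raise-isLinked : ∀ {l l′} → v ≤ o l′ → top l ≤ T → o l′ ≤ T → IsLinked l l′ → IsLinked (raise u l) (raise u l′)
    raise-isLinked {l} v≤o top≤T o≤T K = record
      { b≤o     = ∨-mono (b≤o K) ≤-refl
      ; top≤a   = ≤-trans (raise-top l) (∨-mono (top≤a K) ≤-refl)
      ; a≤top∨o = ∨-least (≤-trans (a≤top∨o K) (∨-mono (∨-mono (∨ˡ ≤-refl) (∨ˡ ≤-refl)) (∨ˡ ≤-refl))) (∨ʳ (∨ʳ ≤-refl))
      ; top∧o≤b = ≤-trans (∧-mono (raise-top l) ≤-refl) (raise-∧ top≤T o≤T v≤o Tu≤v (∨ˡ (top∧o≤b K)) (∨ʳ ≤-refl))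
      }
      where
        raise-top : ∀ l → top (raise u l) ≤ top l ∨ u
        raise-top l = ∨-least (∨-mono (∨ˡ ≤-refl) ≤-refl) (∨-mono (∨ʳ ≤-refl) ≤-refl)

  raise-id : ∀ {w l} → w ≤ o l → IsFrame l → raise w l ≈ᶠ l
  raise-id w≤o F = record
    { o-≈ = ∨-absorb w≤o
    ; a-≈ = ∨-absorb (≤-trans w≤o (o≤a F))
    ; b-≈ = ∨-absorb (≤-trans w≤o (o≤b F))
    ; d-≈ = ∨-absorb (≤-trans w≤o (o≤d F))
    }

  -- Towers of frames.

  Floors : ℕ → Set c
  Floors m = Fin (suc m) → Floor Carrier

  record IsTower {m : ℕ} (f : Floors m) : Set ℓ where
    constructor isTower
    field
      frame : ∀ i → IsFrame (f i)
      link  : ∀ i → IsLinked (f (inject₁ i)) (f (suc i))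

  open IsTower public

  isTower-resp : ∀ {m} {f g : Floors m} → (∀ i → f i ≈ᶠ g i) → IsTower f → IsTower g
  isTower-resp E T = isTower (λ i → isFrame-resp (E i) (frame T i))
                             (λ i → isLinked-resp (E (inject₁ i)) (E (suc i)) (link T i))

  isTower-init : ∀ {m} {f : Floors (suc m)} → IsTower f → IsTower (f ∘ inject₁)
  isTower-init T = isTower (frame T ∘ inject₁) (link T ∘ inject₁)

  -- [o₁,a₁] transposes up to [o,a].
  record IsAbove (o₁ a₁ : Carrier) (l : Floor Carrier) : Set ℓ where
    constructor isAbove
    field
      base-o≤o : o₁ ≤ o l
      base-a≤a : a₁ ≤ a l
      a≤base∨o : a l ≤ a₁ ∨ o l
      base∧o≤o : a₁ ∧ o l ≤ o₁

  open IsAbove public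

  -- Transpositions compose: the interval from `o l` to `a l` transposes up to the one from `b l` to
  -- `top l` because `l` is a frame, and the link carries that one to the next floor.
  isAbove-step : ∀ {o₁ a₁ l l′} → IsFrame l → IsLinked l l′ → IsAbove o₁ a₁ l → IsAbove o₁ a₁ l′
  isAbove-step F K B = record
    { base-o≤o = ≤-trans (base-o≤o B) (≤-trans (o≤b F) (b≤o K))
    ; base-a≤a = ≤-trans (base-a≤a B) (≤-trans (∨ˡ ≤-refl) (top≤a K))
    ; a≤base∨o = ≤-trans (a≤top∨o K) (∨-least (∨-least
                   (≤-trans (a≤base∨o B) (∨-mono ≤-refl (≤-trans (o≤b F) (b≤o K))))
                   (∨ʳ (b≤o K))) (∨ʳ ≤-refl))
    ; base∧o≤o = ≤-trans (∧-greatest (∧ˡ ≤-refl) (≤-trans (∧-greatest (∧ˡ (base-a≤a B))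
                   (≤-trans (∧-mono (≤-trans (base-a≤a B) (∨ˡ ≤-refl)) ≤-refl) (top∧o≤b K))) (ab≤o F)))
                   (base∧o≤o B)
    }

  isTower-above : ∀ {m} {f : Floors m} → IsTower f → ∀ i → IsAbove (o (f zero)) (a (f zero)) (f i)
  isTower-above T = <-weakInduction (IsAbove _ _ ∘ _)
    (isAbove ≤-refl ≤-refl (∨ˡ ≤-refl) (∧ʳ ≤-refl))
    (λ i → isAbove-step (frame T (inject₁ i)) (link T i))

  base∧b≤o : ∀ {o₁ a₁ l} → IsFrame l → IsAbove o₁ a₁ l → a₁ ∧ b l ≤ o₁
  base∧b≤o F B = ≤-trans (∧-greatest (∧ˡ ≤-refl) (≤-trans (∧-mono (base-a≤a B) ≤-refl) (ab≤o F))) (base∧o≤o B)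

  top≤height : ∀ {m} {f : Floors m} → IsTower f → ∀ i → top (f i) ≤ height f
  top≤height {f = f} T = >-weakInduction (λ i → top (f i) ≤ height f) ≤-refl
    (λ i → ≤-trans (≤-trans (top≤a (link T i)) (∨ˡ ≤-refl)))

  -- The condition of `shrink-isLinked` is met with the first `a` as `x`: by transposition it meets
  -- every `b` of the tower inside the first bottom, which is below `p`.
  shrink-isTower : ∀ {m p q} {f : Floors m} → p ≤ q → q ≤ a (f zero) → o (f zero) ≤ p →
                   IsTower f → IsTower (shrink p q ∘ f)
  shrink-isTower p≤q q≤a o≤p T = isTower
    (λ i → shrink-isFrame p≤q (≤-trans q≤a (base-a≤a (isTower-above T i))) (frame T i))
    (λ i → shrink-isLinked p≤q q≤a (≤-trans (base∧b≤o (frame T (suc i)) (isTower-above T (suc i))) o≤p)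
             (frame T (suc i)) (link T i))

  shrink-tower-id : ∀ {m p q} {f : Floors m} → p ≤ o (f zero) → q ≤ a (f zero) → a (f zero) ≤ q →
                    IsTower f → ∀ i → shrink p q (f i) ≈ᶠ f i
  shrink-tower-id p≤o q≤a a≤q T i =
    shrink-id (≤-trans p≤o (base-o≤o B)) (≤-trans q≤a (base-a≤a B))
      (≤-trans (a≤base∨o B) (∨-mono a≤q ≤-refl)) (frame T i)
    where B = isTower-above T i

  median-top≤upper : top (median x y z) ≤ upper x y z
  median-top≤upper = ∨-least (∨-least (∧ʳ ≤-refl) lower≤upper) (∨-least (∧ʳ ≤-refl) lower≤upper)

  module _ {m : ℕ} {f : Floors m} (T : IsTower f) (x : Floor Carrier) where
    private
      l₁ = f zero
      l  = f (fromℕ m)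
      w  = b x ∧ d x ∨ b l
      N  = next l x
      p  = a l₁ ∧ o N
      q  = a l₁ ∧ top N
      F  = frame T (fromℕ m)
      B  = isTower-above T (fromℕ m)

      N-isFrame : IsFrame N
      N-isFrame = median-isFrame (top l ∨ w) (b x ∨ w) (d x ∨ w)

      p≤q : p ≤ q
      p≤q = ∧-mono ≤-refl (≤-trans (o≤a N-isFrame) (∨ˡ ≤-refl))

      w≤oN : w ≤ o N
      w≤oN = ∨ʳ (∨ʳ (∧-greatest (∨ʳ ≤-refl) (∨ʳ ≤-refl)))

      b≤oN : b l ≤ o N
      b≤oN = ≤-trans (∨ʳ ≤-refl) w≤oN

      o₁≤p : o l₁ ≤ p
      o₁≤p = ∧-greatest (o≤a (frame T zero)) (≤-trans (base-o≤o B) (≤-trans (o≤b F) b≤oN))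

      q≤top : q ≤ top l
      q≤top = ∧ˡ (≤-trans (base-a≤a B) (∨ˡ ≤-refl))

      -- Above `w` the first entry `a l₁` already reaches all of `top l`; this is why an interval on
      -- the first floor can control the new floor.
      top≤a₁∨w : top l ∨ w ≤ w ∨ a l₁
      top≤a₁∨w = ∨-least
        (∨-least (≤-trans (a≤base∨o B) (∨-least (∨ʳ ≤-refl) (∨ˡ (∨ʳ (o≤b F))))) (∨ˡ (∨ʳ ≤-refl)))
        (∨ˡ ≤-refl)

      N-isLinked : IsLinked (shrink p q l) N
      N-isLinked = record
        { b≤o     = ∨-least (∧ʳ ≤-refl) (∧ˡ b≤oN)
        ; top≤a   = ∨-least (∨-least q≤aN (∧ˡ b≤aN)) (∨-least (∧ʳ (o≤a N-isFrame)) (∧ˡ b≤aN))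
        -- Since `w` is below the upper median, modularity splits the first argument of the median
        -- into `w`, which is in `o N`, and a part of `a l₁`, which is in `q`.
        ; a≤top∨o = ∨-least
                      (modular-≤ (≤-trans w≤oN (≤-trans (o≤a N-isFrame) (≤-trans (∨ˡ ≤-refl) median-top≤upper)))
                        (∧ˡ top≤a₁∨w) (∧ʳ ≤-refl)
                        (∨ʳ w≤oN)
                        (∨ˡ (∨ˡ (∨ˡ (∧-mono ≤-refl upper≤topN)))))
                      (∨ʳ ≤-refl)
        -- Modulo `b l`, the top of the shrunken floor is `q`, and `q ∧ o N` is below `p` by the
        -- choice of `p`.
        ; top∧o≤b = modular-≤ʳ (∧ˡ b≤oN)
                      (∧ˡ (∨-least (∨-mono ≤-refl (∧-mono ≤-refl (∨-mono p≤q ≤-refl))) (∨-mono p≤q ≤-refl)))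
                      (∧ʳ ≤-refl) (∨ʳ ≤-refl) (∨ˡ (∧-mono (∧ˡ ≤-refl) ≤-refl))
        }
        where
          upper≤topN : upper (top l ∨ w) (b x ∨ w) (d x ∨ w) ≤ top N
          upper≤topN = upper≤median-top
          q≤aN : q ≤ a N
          q≤aN = ∨ˡ (∧-greatest (≤-trans q≤top (∨ˡ ≤-refl)) (∧ʳ median-top≤upper))
          b≤aN : b l ≤ a N
          b≤aN = ≤-trans b≤oN (o≤a N-isFrame)

    extend-isTower : IsTower (extend f x)
    extend-isTower = isTower
      (snoc-elim (λ _ → IsFrame) (frame shrunk) N-isFrame)
      (snoc-consecutive IsLinked (link shrunk) N-isLinked)
      where
        shrunk : IsTower (shrink p q ∘ f)
        shrunk = shrink-isTower p≤q (∧ˡ ≤-refl) o₁≤p T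

    module _ (K : IsLinked l x) (G : IsFrame x) where
      private
        w≈o : w ≈ o x
        w≈o = antisym (∨-least (bd≤o G) (b≤o K)) (∨ˡ (∧-greatest (o≤b G) (o≤d G)))

        ∨w : o x ≤ y → y ≈ y ∨ w
        ∨w o≤y = antisym (∨ˡ ≤-refl) (∨-least ≤-refl (≤-trans (≤-reflexive w≈o) o≤y))

        -- So the three arguments of `median` in `N` are the entries `a x`, `b x`, `d x`, and
        -- `median-id` applies.
        lifted : x ≈ᶠ floor w (top l ∨ w) (b x ∨ w) (d x ∨ w)
        lifted = record
          { o-≈ = sym w≈o
          ; a-≈ = antisym (≤-trans (a≤top∨o K) (∨-mono ≤-refl (≤-reflexive (sym w≈o))))
                          (∨-least (top≤a K) (≤-trans (≤-reflexive w≈o) (o≤a G)))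
          ; b-≈ = ∨w (o≤b G)
          ; d-≈ = ∨w (o≤d G)
          }

        N≈x : N ≈ᶠ x
        N≈x = ≈ᶠ-trans (median-id (isFrame-resp lifted G)) (≈ᶠ-sym lifted)

        B′ : IsAbove (o l₁) (a l₁) x
        B′ = isAbove-step F K B

      -- The target `g` is separate from `f` and `x` because, in the induction of `tower-id`, the
      -- rebuilt lower floors agree with the given ones only up to `≈ᶠ`.
      extend-id : {g : Floors (suc m)} → (∀ i → f i ≈ᶠ g (inject₁ i)) → x ≈ᶠ g (fromℕ (suc m)) →
                  ∀ i → extend f x i ≈ᶠ g i
      extend-id {g} f≈g x≈g = snoc-elim (λ i k → k ≈ᶠ g i)
        (λ i → ≈ᶠ-trans (shrink-tower-id
                  (≤-trans (∧-mono ≤-refl (≤-reflexive (o-≈ N≈x))) (base∧o≤o B′))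
                  (∧ˡ ≤-refl)
                  (∧-greatest ≤-refl (≤-trans (base-a≤a B′) (∨ˡ (≤-reflexive (sym (a-≈ N≈x))))))
                  T i) (f≈g i))
        (≈ᶠ-trans N≈x x≈g)

  tower-isTower : ∀ {m} (f : Floors m) → IsTower (tower m f)
  tower-isTower {zero}  f = isTower (λ _ → median-isFrame _ _ _) (λ ())
  tower-isTower {suc m} f = extend-isTower (tower-isTower (f ∘ inject₁)) (f (fromℕ (suc m)))

  tower-id : ∀ {m} {f : Floors m} → IsTower f → ∀ i → tower m f i ≈ᶠ f i
  tower-id {zero}  T zero = median-id (frame T zero)
  tower-id {suc m} {f} T = extend-id (tower-isTower (f ∘ inject₁)) (f (fromℕ (suc m)))
    (isLinked-resp (≈ᶠ-sym (IH (fromℕ m))) ≈ᶠ-refl (link T (fromℕ m)))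
    (frame T (fromℕ (suc m))) IH ≈ᶠ-refl
    where
      IH : ∀ i → tower m (f ∘ inject₁) i ≈ᶠ f (inject₁ i)
      IH = tower-id (isTower-init T)

  -- Intervals are closed under the construction.

  record Between (lo hi x : Carrier) : Set ℓ where
    constructor _,_
    field
      lo≤ : lo ≤ x
      ≤hi : x ≤ hi

  open Between public

  record FloorBetween (lo hi : Carrier) (l : Floor Carrier) : Set ℓ where
    constructor floorBetween
    field
      o-in : Between lo hi (o l)
      a-in : Between lo hi (a l)
      b-in : Between lo hi (b l)
      d-in : Between lo hi (d l)

  open FloorBetween public

  module _ {lo hi : Carrier} where
    private
      In  = Between lo hi
      InF = FloorBetween lo hi

    ∨-in : In x → In y → In (x ∨ y)
    ∨-in (p , q) (p′ , q′) = ∨ˡ p , ∨-least q q′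

    ∧-in : In x → In y → In (x ∧ y)
    ∧-in (p , q) (p′ , q′) = ∧-greatest p p′ , ∧ˡ q

    top-in : ∀ {l} → InF l → In (top l)
    top-in (floorBetween _ a∈ b∈ _) = ∨-in a∈ b∈

    median-in : In x → In y → In z → InF (median x y z)
    median-in x∈ y∈ z∈ = floorBetween u∈ (part x∈) (part y∈) (part z∈)
      where
        u∈ = ∨-in (∧-in x∈ y∈) (∨-in (∧-in x∈ z∈) (∧-in y∈ z∈))
        v∈ = ∧-in (∨-in x∈ y∈) (∧-in (∨-in x∈ z∈) (∨-in y∈ z∈))
        part : In t → In (t ∧ upper _ _ _ ∨ lower _ _ _)
        part t∈ = ∨-in (∧-in t∈ v∈) u∈

    shrink-in : ∀ {p q l} → In p → In q → InF l → InF (shrink p q l)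
    shrink-in p∈ q∈ (floorBetween o∈ a∈ b∈ d∈) = floorBetween
      (∨-in p∈ (∧-in b∈ (∨-in p∈ d∈))) (∨-in q∈ (∧-in b∈ (∨-in p∈ d∈)))
      (∨-in p∈ (∧-in b∈ (∨-in q∈ d∈))) (∨-in p∈ (∧-in d∈ (∨-in q∈ b∈)))

    raise-in : ∀ {w l} → In w → InF l → InF (raise w l)
    raise-in w∈ (floorBetween o∈ a∈ b∈ d∈) = floorBetween (∨-in o∈ w∈) (∨-in a∈ w∈) (∨-in b∈ w∈) (∨-in d∈ w∈)

    extend-in : ∀ {m l} {f : Floors m} → (∀ i → InF (f i)) → InF l → ∀ i → InF (extend f l i)
    extend-in {m} f∈ (floorBetween _ _ b∈ d∈) = snoc-elim (λ _ → InF)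
      (λ i → shrink-in (∧-in (a-in (f∈ zero)) (o-in N∈)) (∧-in (a-in (f∈ zero)) (top-in N∈)) (f∈ i)) N∈
      where
        w∈ = ∨-in (∧-in b∈ d∈) (b-in (f∈ (fromℕ m)))
        N∈ = median-in (∨-in (top-in (f∈ (fromℕ m))) w∈) (∨-in b∈ w∈) (∨-in d∈ w∈)

    tower-in : ∀ {m} {f : Floors m} → (∀ i → InF (f i)) → ∀ i → InF (tower m f i)
    tower-in {zero}  f∈ i = median-in (a-in (f∈ zero)) (b-in (f∈ zero)) (d-in (f∈ zero))
    tower-in {suc m} f∈   = extend-in (tower-in (f∈ ∘ inject₁)) (f∈ (fromℕ (suc m)))

  -- The entries `a₃` and `c₁₃`.

  record IsTower₃ {m : ℕ} (M : Tower₃ m) : Set ℓ where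
    constructor isTower₃
    field
      floors-isTower : IsTower (floors M)
      indep₃  : height (floors M) ∧ e M ≤ o (floors M zero)
      frame₃  : IsFrame (floor (o (floors M zero)) (a (floors M zero)) (e M) (k M))

  open IsTower₃ public

  record _≈₃_ {m : ℕ} (M M′ : Tower₃ m) : Set ℓ where
    constructor tower₃-≈
    field
      floors-≈ : ∀ i → floors M i ≈ᶠ floors M′ i
      e-≈      : e M ≈ e M′
      k-≈      : k M ≈ k M′

  open _≈₃_ public

  ≈₃-sym : ∀ {m} {M M′ : Tower₃ m} → M ≈₃ M′ → M′ ≈₃ M
  ≈₃-sym (tower₃-≈ f≈ e≈ k≈) = tower₃-≈ (≈ᶠ-sym ∘ f≈) (sym e≈) (sym k≈)

  ≈₃-trans : ∀ {m} {M M′ M″ : Tower₃ m} → M ≈₃ M′ → M′ ≈₃ M″ → M ≈₃ M″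
  ≈₃-trans (tower₃-≈ f≈ e≈ k≈) (tower₃-≈ f≈′ e≈′ k≈′) =
    tower₃-≈ (λ i → ≈ᶠ-trans (f≈ i) (f≈′ i)) (trans e≈ e≈′) (trans k≈ k≈′)

  isTower₃-resp : ∀ {m} {M M′ : Tower₃ m} → M ≈₃ M′ → IsTower₃ M → IsTower₃ M′
  isTower₃-resp {m} (tower₃-≈ f≈ e≈ k≈) (isTower₃ T I F) = isTower₃ (isTower-resp f≈ T)
    (≤-resp (∧-cong (top-cong (f≈ (fromℕ m))) e≈) (o-≈ (f≈ zero)) I)
    (isFrame-resp (floor-≈ (o-≈ (f≈ zero)) (a-≈ (f≈ zero)) e≈ k≈) F)

  base≤height : ∀ {m} {f : Floors m} → IsTower f → a (f zero) ≤ height f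
  base≤height T = ≤-trans (∨ˡ ≤-refl) (top≤height T zero)

  -- From `d l ≤ a l ∨ b l` and `a l ≤ T`, modularity gives that `T ∧ d l` is below
  -- `a l ∨ (b l ∧ T)`, hence below `a l`; and `a l ∧ d l` is below the bottom.
  indep-other : ∀ {T l} → a l ≤ T → T ∧ b l ≤ o l → IsFrame l → T ∧ d l ≤ o l
  indep-other a≤T Tb≤o F = ≤-trans (∧-greatest Td≤a (∧ʳ ≤-refl)) (ad≤o F)
    where
      Td≤a = modular-≤ a≤T (∧ʳ (d≤a∨b F)) (∧ˡ ≤-refl) ≤-refl (≤-trans ∧-swap (≤-trans Tb≤o (o≤a F)))

  floor-≤T : ∀ {T l} → IsFrame l → top l ≤ T → (o l ≤ T × a l ≤ T × b l ≤ T × d l ≤ T)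
  floor-≤T F top≤T = ≤-trans (o≤a F) a≤T , a≤T , ≤-trans (∨ʳ ≤-refl) top≤T , ≤-trans (d≤a∨b F) top≤T
    where a≤T = ≤-trans (∨ˡ ≤-refl) top≤T

  raise-between : ∀ {w T l} → IsFrame l → top l ≤ T → w ≤ T → FloorBetween w T (raise w l)
  raise-between {w} {T} F top≤T w≤T with o≤T , a≤T , b≤T , d≤T ← floor-≤T F top≤T =
    floorBetween (go o≤T) (go a≤T) (go b≤T) (go d≤T)
    where
      go : x ≤ T → Between w T (x ∨ w)
      go x≤T = ∨ʳ ≤-refl , ∨-least x≤T w≤T

  raise-isTower : ∀ {m T u} {f : Floors m} → IsTower f → height f ≤ T → T ∧ u ≤ o (f zero) → IsTower (raise u ∘ f)
  raise-isTower {T = T} {f = f} I h≤T Tu≤o = isTower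
    (λ i → let _ , a≤T , b≤T , d≤T = bounds i in
       raise-isFrame Tu≤o (base-o≤o (isTower-above I i)) a≤T b≤T d≤T (frame I i))
    (λ i → raise-isLinked Tu≤o (base-o≤o (isTower-above I (suc i))) (≤-trans (top≤height I (inject₁ i)) h≤T)
             (proj₁ (bounds (suc i))) (link I i))
    where
      bounds : ∀ i → o (f i) ≤ T × a (f i) ≤ T × b (f i) ≤ T × d (f i) ≤ T
      bounds i = floor-≤T (frame I i) (≤-trans (top≤height I i) h≤T)

  raise-tower-id : ∀ {m w} {f : Floors m} → IsTower f → w ≤ o (f zero) → ∀ i → raise w (f i) ≈ᶠ f i
  raise-tower-id I w≤o i = raise-id (≤-trans w≤o (base-o≤o (isTower-above I i))) (frame I i)

  -- Modularity first splits off `u`, using `u ≤ g ∨ v`, and then reduces `T ∧ (g ∨ v)` to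
  -- `v ∨ (g ∧ T)`, which is `v`.
  raise-indep : ∀ {T u g v} → v ≤ T → T ∧ g ≤ v → u ≤ g ∨ v → (T ∨ u) ∧ (g ∨ v) ≤ v ∨ u
  raise-indep v≤T Tg≤v u≤gv = modular-≤ʳ u≤gv (∧ˡ ≤-refl) (∧ʳ ≤-refl) (∨ʳ ≤-refl)
    (∨ˡ (modular-≤ʳ v≤T (∧ʳ ≤-refl) (∧ˡ ≤-refl) ≤-refl (≤-trans ∧-swap Tg≤v)))

  module _ {m : ℕ} {f : Floors m} (I : IsTower f) (e k : Carrier) where
    private
      T  = height f
      w  = T ∧ e ∨ T ∧ k
      f₁ = tower m (raise w ∘ f)
      o₁ = o (f₁ zero)
      e₁ = e ∨ o₁
      k₁ = k ∨ o₁
      u  = e₁ ∧ k₁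
      f₂ = raise u ∘ f₁
      o₂ = o (f₂ zero)
      a′ = a (f₂ zero)
      N  = median a′ e₁ k₁
      q  = a′ ∧ top N

      I₁ : IsTower f₁
      I₁ = tower-isTower (raise w ∘ f)

      w≤T : w ≤ T
      w≤T = ∨-least (∧ˡ ≤-refl) (∧ˡ ≤-refl)

      f₁∈ : ∀ i → FloorBetween w T (f₁ i)
      f₁∈ = tower-in (λ i → raise-between (frame I i) (top≤height I i) w≤T)

      height₁≤T : height f₁ ≤ T
      height₁≤T = ≤hi (top-in (f₁∈ (fromℕ m)))

      o₁≤height : o₁ ≤ height f₁
      o₁≤height = ≤-trans (o≤a (frame I₁ zero)) (base≤height I₁)

      indep-e : height f₁ ∧ e ≤ o₁
      indep-e = ≤-trans (∧-mono height₁≤T ≤-refl) (≤-trans (∨ˡ ≤-refl) (lo≤ (o-in (f₁∈ zero))))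

      indep-k : height f₁ ∧ k ≤ o₁
      indep-k = ≤-trans (∧-mono height₁≤T ≤-refl) (≤-trans (∨ʳ ≤-refl) (lo≤ (o-in (f₁∈ zero))))

      raised-e : (height f₁ ∨ u) ∧ e₁ ≤ o₂
      raised-e = raise-indep o₁≤height indep-e (∧ˡ ≤-refl)

      raised-k : (height f₁ ∨ u) ∧ k₁ ≤ o₂
      raised-k = raise-indep o₁≤height indep-k (∧ʳ ≤-refl)

      indep-u : height f₁ ∧ u ≤ o₁
      indep-u = modular-≤ʳ o₁≤height (∧ʳ (∧ˡ ≤-refl)) (∧ˡ ≤-refl) ≤-refl (≤-trans ∧-swap indep-e)

      I₂ : IsTower f₂
      I₂ = raise-isTower I₁ ≤-refl indep-u

      o₂≤e₁ : o₂ ≤ e₁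
      o₂≤e₁ = ∨-least (∨ʳ ≤-refl) (∧ˡ ≤-refl)

      o₂≤k₁ : o₂ ≤ k₁
      o₂≤k₁ = ∨-least (∨ʳ ≤-refl) (∧ʳ ≤-refl)

      a′≤ : a′ ≤ height f₁ ∨ u
      a′≤ = ∨-mono (base≤height I₁) ≤-refl

      -- Two joinands of the lower median vanish into `o₂` by independence; the third is `u`, which
      -- was joined to the bottom for this purpose.
      oN≤o₂ : o N ≤ o₂
      oN≤o₂ = ∨-least (≤-trans (∧-mono a′≤ ≤-refl) raised-e)
                (∨-least (≤-trans (∧-mono a′≤ ≤-refl) raised-k) (∨ʳ ≤-refl))

      o₂≤oN : o₂ ≤ o N
      o₂≤oN = ∨ʳ (∨ʳ (∧-greatest o₂≤e₁ o₂≤k₁))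

      N-isFrame : IsFrame N
      N-isFrame = median-isFrame a′ e₁ k₁

      o₂≤a′ : o₂ ≤ a′
      o₂≤a′ = o≤a (frame I₂ zero)

      o₂≤q : o₂ ≤ q
      o₂≤q = ∧-greatest o₂≤a′ (≤-trans o₂≤oN (≤-trans (o≤a N-isFrame) (∨ˡ ≤-refl)))

      f₃ : Floors m
      f₃ = shrink o₂ q ∘ f₂

      -- The perspectivity sends the bottom to itself, so on the first floor shrinking keeps the
      -- bottom and only replaces `a′` by `q`.
      p′≤o₂ : b (f₂ zero) ∧ (o₂ ∨ d (f₂ zero)) ≤ o₂
      p′≤o₂ = ≤-trans (∧-mono ≤-refl (∨-least (o≤d (frame I₂ zero)) ≤-refl)) (bd≤o (frame I₂ zero))

      o₃≈ : o N ≈ o (f₃ zero)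
      o₃≈ = antisym (∨ˡ oN≤o₂) (≤-trans (∨-least ≤-refl p′≤o₂) o₂≤oN)

      a₃≈ : a N ≈ a (f₃ zero)
      a₃≈ = antisym (∨ˡ (∧-greatest (∨-least (∧ˡ ≤-refl) (≤-trans oN≤o₂ o₂≤a′)) (∨ˡ ≤-refl)))
                    (∨-least (∨ˡ (∧-mono ≤-refl median-top≤upper)) (≤-trans p′≤o₂ (∨ʳ o₂≤oN)))

      height₃≤ : height f₃ ≤ height f₁ ∨ u
      height₃≤ = ≤-trans (shrink-top {l = f₂ (fromℕ m)} (≤-trans o₂≤a′ a′≤a) (∧ˡ a′≤a))
                   (∨-least (∨-mono (∨ˡ ≤-refl) ≤-refl) (∨-mono (∨ʳ ≤-refl) ≤-refl))
        where
          a′≤a : a′ ≤ a (f₂ (fromℕ m))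
          a′≤a = base-a≤a (isTower-above I₂ (fromℕ m))

    attach₃-isTower₃ : IsTower₃ (attach₃ f e k)
    attach₃-isTower₃ = isTower₃ (shrink-isTower o₂≤q (∧ˡ ≤-refl) ≤-refl I₂)
      (≤-trans (∧-mono height₃≤ (∨-least (∧ˡ ≤-refl) (≤-trans oN≤o₂ o₂≤e₁))) (∨ˡ raised-e))
      (isFrame-resp (floor-≈ o₃≈ a₃≈ refl refl) N-isFrame)

    attach₃-id : IsTower₃ (tower₃ f e k) → attach₃ f e k ≈₃ tower₃ f e k
    attach₃-id (isTower₃ _ Te≤o F) = tower₃-≈
      (λ i → ≈ᶠ-trans (shrink-tower-id ≤-refl (∧ˡ ≤-refl)
                (∧-greatest ≤-refl (∨ˡ (≤-reflexive (sym (a-≈ N≈))))) I₂ i) (f₂≈f i))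
      (trans (b-≈ N≈) e₁≈e) (trans (d-≈ N≈) k₁≈k)
      where
        -- Independence of `e` is a relation of the tower; independence of `k` follows from it by
        -- `indep-other`.
        w≤o : w ≤ o (f zero)
        w≤o = ∨-least Te≤o (indep-other (base≤height I) Te≤o F)

        f₁≈f : ∀ i → f₁ i ≈ᶠ f i
        f₁≈f i = ≈ᶠ-trans (tower-id (isTower-resp (≈ᶠ-sym ∘ raise-tower-id I w≤o) I) i) (raise-tower-id I w≤o i)

        o₁≈o : o₁ ≈ o (f zero)
        o₁≈o = o-≈ (f₁≈f zero)

        e₁≈e : e₁ ≈ e
        e₁≈e = ∨-absorb (≤-trans (≤-reflexive o₁≈o) (o≤b F))

        k₁≈k : k₁ ≈ k
        k₁≈k = ∨-absorb (≤-trans (≤-reflexive o₁≈o) (o≤d F))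

        f₂≈f : ∀ i → f₂ i ≈ᶠ f i
        f₂≈f i = ≈ᶠ-trans (raise-tower-id I₁ (≤-resp (∧-cong (sym e₁≈e) (sym k₁≈k)) (sym o₁≈o) (bd≤o F)) i) (f₁≈f i)

        N≈ : N ≈ᶠ floor o₂ a′ e₁ k₁
        N≈ = median-id (isFrame-resp
               (floor-≈ (sym (o-≈ (f₂≈f zero))) (sym (a-≈ (f₂≈f zero))) (sym e₁≈e) (sym k₁≈k)) F)

  record Between₃ {m : ℕ} (lo hi : Carrier) (M : Tower₃ m) : Set ℓ where
    constructor between₃
    field
      floors-in : ∀ i → FloorBetween lo hi (floors M i)
      e-in      : Between lo hi (e M)
      k-in      : Between lo hi (k M)

  open Between₃ public

  attach₃-in : ∀ {lo hi m e k} {f : Floors m} → (∀ i → FloorBetween lo hi (f i)) →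
               Between lo hi e → Between lo hi k → Between₃ lo hi (attach₃ f e k)
  attach₃-in {m = m} f∈ e∈ k∈ =
    between₃ (shrink-in (o-in (f₂∈ zero)) (∧-in (a-in (f₂∈ zero)) (top-in N∈)) ∘ f₂∈) (b-in N∈) (d-in N∈)
    where
      T∈  = top-in (f∈ (fromℕ m))
      f₁∈ = tower-in (raise-in (∨-in (∧-in T∈ e∈) (∧-in T∈ k∈)) ∘ f∈)
      e₁∈ = ∨-in e∈ (o-in (f₁∈ zero))
      k₁∈ = ∨-in k∈ (o-in (f₁∈ zero))
      f₂∈ = raise-in (∧-in e₁∈ k₁∈) ∘ f₁∈
      N∈  = median-in (a-in (f₂∈ zero)) e₁∈ k₁∈

  opaque
    unfolding retract₃

    retract₃-in : ∀ {lo hi m} {M : Tower₃ m} → Between₃ lo hi M → Between₃ lo hi (retract₃ M)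
    retract₃-in (between₃ f∈ e∈ k∈) = attach₃-in (tower-in f∈) e∈ k∈

    retract₃-isTower₃ : ∀ {m} (M : Tower₃ m) → IsTower₃ (retract₃ M)
    retract₃-isTower₃ M = attach₃-isTower₃ (tower-isTower (floors M)) (e M) (k M)

    retract₃-id : ∀ {m} {M : Tower₃ m} → IsTower₃ M → retract₃ M ≈₃ M
    retract₃-id {M = M} I = ≈₃-trans
      (attach₃-id (tower-isTower (floors M)) (e M) (k M) (isTower₃-resp (≈₃-sym E) I)) E
      where
        E : tower₃ (tower _ (floors M)) (e M) (k M) ≈₃ M
        E = tower₃-≈ (tower-id (floors-isTower I)) refl refl

  k≤height₃ : ∀ {m} {M : Tower₃ m} → IsTower₃ M → k M ≤ height₃ M
  k≤height₃ I = ≤-trans (d≤a∨b (frame₃ I)) (∨-mono (base≤height (floors-isTower I)) ≤-refl)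

  o≤height₃ : ∀ {m} {M : Tower₃ m} → IsTower₃ M → o (floors M zero) ≤ height₃ M
  o≤height₃ I = ∨ʳ (o≤b (frame₃ I))

  raise₃-isTower₃ : ∀ {m u} {M : Tower₃ m} → IsTower₃ M → height₃ M ∧ u ≤ o (floors M zero) → IsTower₃ (raise₃ u M)
  raise₃-isTower₃ {M = M} I Tu≤o = isTower₃
    (raise-isTower (floors-isTower I) (∨ˡ ≤-refl) Tu≤o)
    (≤-trans (∧-mono (∨-least (∨-mono (∨ˡ ≤-refl) ≤-refl) (∨-mono (∨ʳ ≤-refl) ≤-refl)) ≤-refl)
      (raise-∧ (∨ˡ ≤-refl) (∨ʳ ≤-refl) (o≤b (frame₃ I)) Tu≤o (∨ˡ (indep₃ I)) (∨ʳ ≤-refl)))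
    (raise-isFrame Tu≤o ≤-refl (∨ˡ (base≤height (floors-isTower I))) (∨ʳ ≤-refl) (k≤height₃ I) (frame₃ I))

  raise₃-id : ∀ {m w} {M : Tower₃ m} → IsTower₃ M → w ≤ o (floors M zero) → raise₃ w M ≈₃ M
  raise₃-id I w≤o = tower₃-≈ (raise-tower-id (floors-isTower I) w≤o)
    (∨-absorb (≤-trans w≤o (o≤b (frame₃ I)))) (∨-absorb (≤-trans w≤o (o≤d (frame₃ I))))

  raise₃-between : ∀ {m w} {M : Tower₃ m} → IsTower₃ M → w ≤ height₃ M → Between₃ w (height₃ M) (raise₃ w M)
  raise₃-between I w≤T = between₃
    (λ i → raise-between (frame (floors-isTower I) i) (∨ˡ (top≤height (floors-isTower I) i)) w≤T)
    (∨ʳ ≤-refl , ∨-least (∨ʳ ≤-refl) w≤T) (∨ʳ ≤-refl , ∨-least (k≤height₃ I) w≤T)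

  -- The skew frame with entries `a₄′` and `c₁₄′`.

  record IsTower₄ {m : ℕ} (M : Tower₄ m) : Set ℓ where
    constructor isTower₄
    field
      base-isTower₃ : IsTower₃ (base M)
      indep₄ : height₃ (base M) ∧ g M ≤ o (floors (base M) zero)
      frame₄ : IsFrame (floor (o (floors (base M) zero)) (a (floors (base M) zero) ∧ (g M ∨ h M)) (g M) (h M))

  record _≈₄_ {m : ℕ} (M M′ : Tower₄ m) : Set ℓ where
    constructor tower₄-≈
    field
      base-≈ : base M ≈₃ base M′
      g-≈    : g M ≈ g M′
      h-≈    : h M ≈ h M′

  isTower₄-resp : ∀ {m} {M M′ : Tower₄ m} → M ≈₄ M′ → IsTower₄ M → IsTower₄ M′
  isTower₄-resp {m} (tower₄-≈ E g≈ h≈) (isTower₄ I Tg≤o F) = isTower₄ (isTower₃-resp E I)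
    (≤-resp (∧-cong (∨-cong (top-cong (floors-≈ E (fromℕ m))) (e-≈ E)) g≈) (o-≈ (floors-≈ E zero)) Tg≤o)
    (isFrame-resp (floor-≈ (o-≈ (floors-≈ E zero)) (∧-cong (a-≈ (floors-≈ E zero)) (∨-cong g≈ h≈)) g≈ h≈) F)

  ≈₄-sym : ∀ {m} {M M′ : Tower₄ m} → M ≈₄ M′ → M′ ≈₄ M
  ≈₄-sym (tower₄-≈ E g≈ h≈) = tower₄-≈ (≈₃-sym E) (sym g≈) (sym h≈)

  ≈₄-trans : ∀ {m} {M M′ M″ : Tower₄ m} → M ≈₄ M′ → M′ ≈₄ M″ → M ≈₄ M″
  ≈₄-trans (tower₄-≈ E g≈ h≈) (tower₄-≈ E′ g≈′ h≈′) = tower₄-≈ (≈₃-trans E E′) (trans g≈ g≈′) (trans h≈ h≈′)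

  indep-h₄ : ∀ {m} {M : Tower₃ m} {g h} → IsTower₄ (tower₄ M g h) → height₃ M ∧ h ≤ o (floors M zero)
  indep-h₄ (isTower₄ I Tg≤o F) = indep-other (∧ˡ (∨ˡ (base≤height (floors-isTower I)))) Tg≤o F

  module _ {m : ℕ} {M : Tower₃ m} (I : IsTower₃ M) (g h : Carrier)
           (indep-g : height₃ M ∧ g ≤ o (floors M zero)) (indep-h : height₃ M ∧ h ≤ o (floors M zero)) where
    private
      T  = height₃ M
      o₁ = o (floors M zero)
      g₁ = g ∨ o₁
      h₁ = h ∨ o₁
      u  = g₁ ∧ h₁
      o₂ = o₁ ∨ u
      a′ = a (floors M zero) ∨ u
      r₁ = a′ ∧ (g₁ ∨ h₁)
      g₂ = g₁ ∧ (r₁ ∨ h₁)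
      h₂ = h₁ ∧ (r₁ ∨ g₁)
      r₂ = a′ ∧ (g₂ ∨ h₂)

      raised-g : (T ∨ u) ∧ g₁ ≤ o₂
      raised-g = raise-indep (o≤height₃ I) indep-g (∧ˡ ≤-refl)

      raised-h : (T ∨ u) ∧ h₁ ≤ o₂
      raised-h = raise-indep (o≤height₃ I) indep-h (∧ʳ ≤-refl)

      indep-u : T ∧ u ≤ o₁
      indep-u = modular-≤ʳ (o≤height₃ I) (∧ʳ (∧ˡ ≤-refl)) (∧ˡ ≤-refl) ≤-refl (≤-trans ∧-swap indep-g)

      I₂ : IsTower₃ (raise₃ u M)
      I₂ = raise₃-isTower₃ I indep-u

      a′≤ : a′ ≤ T ∨ u
      a′≤ = ∨-mono (∨ˡ (base≤height (floors-isTower I))) ≤-refl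

      height≤ : height₃ (raise₃ u M) ≤ T ∨ u
      height≤ = ∨-least (∨-least (∨-mono (∨ˡ (∨ˡ ≤-refl)) ≤-refl) (∨-mono (∨ˡ (∨ʳ ≤-refl)) ≤-refl))
                        (∨-mono (∨ʳ ≤-refl) ≤-refl)

      -- As `r₁` is below `g₁ ∨ h₁`, it stays below the join of the parts `g₂` and `h₂` that it
      -- sees, so it may stand in for the frame entry `r₂`.
      r₁≤r₂ : r₁ ≤ r₂
      r₁≤r₂ = ∧-greatest (∧ˡ ≤-refl) (split-≤ (∧ʳ ≤-refl))

      o₂≤g₂ : o₂ ≤ g₂
      o₂≤g₂ = ∧-greatest (∨-least (∨ʳ ≤-refl) (∧ˡ ≤-refl)) (∨ʳ (∨-least (∨ʳ ≤-refl) (∧ʳ ≤-refl)))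

      o₂≤h₂ : o₂ ≤ h₂
      o₂≤h₂ = ∧-greatest (∨-least (∨ʳ ≤-refl) (∧ʳ ≤-refl)) (∨ʳ (∨-least (∨ʳ ≤-refl) (∧ˡ ≤-refl)))

    adjoin₄-isTower₄ : IsTower₄ (adjoin₄ M g h)
    adjoin₄-isTower₄ = isTower₄ I₂ (≤-trans (∧-mono height≤ (∧ˡ ≤-refl)) raised-g) record
      { ab≤o = ≤-trans (∧-mono (∧ˡ a′≤) (∧ˡ ≤-refl)) raised-g
      ; ad≤o = ≤-trans (∧-mono (∧ˡ a′≤) (∧ˡ ≤-refl)) raised-h
      ; bd≤o = ∨ʳ (∧-mono (∧ˡ ≤-refl) (∧ˡ ≤-refl))
      ; o≤a = ∧-greatest (o≤a (frame (floors-isTower I₂) zero)) (∨ˡ o₂≤g₂)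
      ; o≤b = o₂≤g₂
      ; o≤d = o₂≤h₂
      ; a≤b∨d = ∧ʳ ≤-refl
      ; b≤a∨d = modular-≤ (∨ˡ ≤-refl) (∧ʳ ≤-refl) (∧ˡ (∨ʳ ≤-refl)) (∨ˡ r₁≤r₂) (∨ʳ ≤-refl)
      ; d≤a∨b = modular-≤ (∨ˡ ≤-refl) (∧ʳ ≤-refl) (∧ˡ (∨ʳ ≤-refl)) (∨ˡ r₁≤r₂) (∨ʳ ≤-refl)
      }

    adjoin₄-id : IsTower₄ (tower₄ M g h) → adjoin₄ M g h ≈₄ tower₄ M g h
    adjoin₄-id (isTower₄ _ _ F) = tower₄-≈ M₂≈M
      (trans (antisym (∧ˡ ≤-refl) (∧-greatest ≤-refl
         (≤-resp (sym g₁≈g) refl (≤-trans (b≤a∨d F) (∨-mono a≤r₁ (∨ˡ ≤-refl)))))) g₁≈g)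
      (trans (antisym (∧ˡ ≤-refl) (∧-greatest ≤-refl
         (≤-resp (sym h₁≈h) refl (≤-trans (d≤a∨b F) (∨-mono a≤r₁ (∨ˡ ≤-refl)))))) h₁≈h)
      where
        g₁≈g : g₁ ≈ g
        g₁≈g = ∨-absorb (o≤b F)

        h₁≈h : h₁ ≈ h
        h₁≈h = ∨-absorb (o≤d F)

        M₂≈M : raise₃ u M ≈₃ M
        M₂≈M = raise₃-id I (≤-resp (∧-cong (sym g₁≈g) (sym h₁≈h)) refl (bd≤o F))

        a≤r₁ : a (floors M zero) ∧ (g ∨ h) ≤ r₁
        a≤r₁ = ∧-mono (∨ˡ ≤-refl) (∨-mono (∨ˡ ≤-refl) (∨ˡ ≤-refl))

  module _ {m : ℕ} {M : Tower₃ m} (I : IsTower₃ M) (g h : Carrier) where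
    private
      T  = height₃ M
      w  = T ∧ g ∨ T ∧ h
      M₁ = retract₃ (raise₃ w M)

      I₁ : IsTower₃ M₁
      I₁ = retract₃-isTower₃ (raise₃ w M)

      M₁∈ : Between₃ w T M₁
      M₁∈ = retract₃-in (raise₃-between I (∨-least (∧ˡ ≤-refl) (∧ˡ ≤-refl)))

      -- The rebuilt tower lies between `w` and `T`: its join is still below `T`, and its bottom
      -- contains `w`.
      indep : ∀ {x} → T ∧ x ≤ w → height₃ M₁ ∧ x ≤ o (floors M₁ zero)
      indep Tx≤w = ≤-trans (∧-mono (∨-least (≤hi (top-in (floors-in M₁∈ (fromℕ m)))) (≤hi (e-in M₁∈))) ≤-refl)
                     (≤-trans Tx≤w (lo≤ (o-in (floors-in M₁∈ zero))))

    attach₄-isTower₄ : IsTower₄ (attach₄ M g h)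
    attach₄-isTower₄ = adjoin₄-isTower₄ {M = M₁} I₁ g h (indep {g} (∨ˡ ≤-refl)) (indep {h} (∨ʳ ≤-refl))

    attach₄-id : IsTower₄ (tower₄ M g h) → attach₄ M g h ≈₄ tower₄ M g h
    attach₄-id J = ≈₄-trans
      (adjoin₄-id {M = M₁} I₁ g h (indep {g} (∨ˡ ≤-refl)) (indep {h} (∨ʳ ≤-refl)) (isTower₄-resp (≈₄-sym E) J)) E
      where
        M₁≈M : M₁ ≈₃ M
        M₁≈M = ≈₃-trans (retract₃-id (isTower₃-resp (≈₃-sym E) I)) E
          where E = raise₃-id I (∨-least (IsTower₄.indep₄ J) (indep-h₄ J))

        E : tower₄ M₁ g h ≈₄ tower₄ M g h
        E = tower₄-≈ M₁≈M refl refl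

  retract₄-isTower₄ : ∀ {m} (M : Tower₄ m) → IsTower₄ (retract₄ M)
  retract₄-isTower₄ M = attach₄-isTower₄ (retract₃-isTower₃ (base M)) (g M) (h M)

  retract₄-id : ∀ {m} {M : Tower₄ m} → IsTower₄ M → retract₄ M ≈₄ M
  retract₄-id {M = M} I@(isTower₄ I₃ _ _) = tower₄-≈ (≈₃-trans (base-≈ E₄) E₃) (g-≈ E₄) (h-≈ E₄)
    where
      open _≈₄_
      E₃ = retract₃-id I₃
      E₄ = attach₄-id (retract₃-isTower₃ (base M)) (g M) (h M)
             (isTower₄-resp (tower₄-≈ (≈₃-sym E₃) refl refl) I)

  module _ {m : ℕ} {M : Tower₄ m} {ρ : GenΩ (suc m) → Carrier} (E : M ≈₄ fromAssignment ρ) where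
    open _≈₄_ E

    assignment-≈ : ∀ x → toAssignment M x ≈ ρ x
    assignment-≈ (a⊥ i)  = o-≈ (floors-≈ base-≈ i)
    assignment-≈ (a₁ i)  = a-≈ (floors-≈ base-≈ i)
    assignment-≈ (a₂ i)  = b-≈ (floors-≈ base-≈ i)
    assignment-≈ (c₁₂ i) = d-≈ (floors-≈ base-≈ i)
    assignment-≈ a₃      = e-≈ base-≈
    assignment-≈ c₁₃     = k-≈ base-≈
    assignment-≈ a₄′     = g-≈
    assignment-≈ c₁₄′    = h-≈

-- Quantification over lists of indices.

allFin⁺ : ∀ {p n k} {P : Fin k → Set p} → (∀ i → P i) → All P (allFin {n} k)
allFin⁺ {k = zero}  h = []
allFin⁺ {n = n} {k = suc k} h = h zero ∷ map⁺ (allFin⁺ {n = n} (h ∘ suc))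

allFin⁻ : ∀ {p n k} {P : Fin k → Set p} → All P (allFin {n} k) → ∀ i → P i
allFin⁻ (p ∷ ps) zero    = p
allFin⁻ {n = n} (p ∷ ps) (suc i) = allFin⁻ {n = n} (map⁻ ps) i

concatMap⁺ : ∀ {p n k} {A : Set} {P : A → Set p} {f : Fin k → List A} →
             (∀ i → All P (f i)) → All P (concatMap f (allFin {n} k))
concatMap⁺ {n = n} h = concat⁺ (map⁺ (allFin⁺ {n = n} h))

concatMap⁻ : ∀ {p n k} {A : Set} {P : A → Set p} {f : Fin k → List A} →
             All P (concatMap f (allFin {n} k)) → ∀ i → All P (f i)
concatMap⁻ {n = n} ps = allFin⁻ {n = n} (map⁻ (concat⁻ ps))

-- The relations of the presentations as inequalities.

module Relations {c ℓ : Level} (L : ModularLattice c ℓ) where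
  open Modular L

  private
    module Evaluation {V : Set} (ρ : V → Carrier) where
      Holds : Relation V → Set ℓ
      Holds r = ⟦ L ⟧ (proj₁ r) ρ ≈ ⟦ L ⟧ (proj₂ r) ρ

      ⟦_⟧ρ : Term V → Carrier
      ⟦ t ⟧ρ = ⟦ L ⟧ t ρ

      2-frame⁻ : ∀ {s t u v} → All Holds (2-frame s t u v) → IsFrame (floor ⟦ s ⟧ρ ⟦ t ⟧ρ ⟦ u ⟧ρ ⟦ v ⟧ρ)
      2-frame⁻ (o≈ba ∷ o≈ad ∷ ad≈bd ∷ ab≈ad ∷ ad≈bd′ ∷ []) = record
        { ab≤o = ≤-trans ∧-swap (≤-reflexive (sym o≈ba))
        ; ad≤o = ≤-reflexive (sym o≈ad)
        ; bd≤o = ≤-reflexive (sym (trans o≈ad ad≈bd))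
        ; o≤a = ≤-trans (≤-reflexive o≈ba) (∧ʳ ≤-refl)
        ; o≤b = ≤-trans (≤-reflexive o≈ba) (∧ˡ ≤-refl)
        ; o≤d = ≤-trans (≤-reflexive o≈ad) (∧ʳ ≤-refl)
        ; a≤b∨d = ≤-trans (∨ˡ ≤-refl) (≤-reflexive ad≈bd′)
        ; b≤a∨d = ≤-trans (∨ʳ ≤-refl) (≤-reflexive ab≈ad)
        ; d≤a∨b = ≤-trans (∨ʳ ≤-refl) (≤-reflexive (sym ab≈ad))
        }

      2-frame⁺ : ∀ {s t u v} → IsFrame (floor ⟦ s ⟧ρ ⟦ t ⟧ρ ⟦ u ⟧ρ ⟦ v ⟧ρ) → All Holds (2-frame s t u v)
      2-frame⁺ F =
        antisym (∧-greatest (o≤b F) (o≤a F)) (≤-trans ∧-swap (ab≤o F)) ∷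
        antisym (∧-greatest (o≤a F) (o≤d F)) (ad≤o F) ∷
        antisym (∧-greatest (≤-trans (ad≤o F) (o≤b F)) (∧ʳ ≤-refl))
                (∧-greatest (≤-trans (bd≤o F) (o≤a F)) (∧ʳ ≤-refl)) ∷
        antisym (∨-least (∨ˡ ≤-refl) (b≤a∨d F)) (∨-least (∨ˡ ≤-refl) (d≤a∨b F)) ∷
        antisym (∨-least (a≤b∨d F) (∨ʳ ≤-refl)) (∨-least (b≤a∨d F) (∨ʳ ≤-refl)) ∷ []

      ↗⁻ : ∀ {x x′ y y′} → All Holds ((x ∷ x′ ∷ []) ↗ (y ∷ y′ ∷ [])) →
           ⟦ x′ ⟧ρ ≤ ⟦ y′ ⟧ρ × ⟦ x ⟧ρ ≤ ⟦ y ⟧ρ × ⟦ y ⟧ρ ≤ ⟦ x ⟧ρ ∨ ⟦ y′ ⟧ρ × ⟦ x ⟧ρ ∧ ⟦ y′ ⟧ρ ≤ ⟦ x′ ⟧ρ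
      ↗⁻ (y≈ ∷ y′≈ ∷ x≈ ∷ x′≈ ∷ []) =
        ≤-trans (∨ˡ ≤-refl) (≤-reflexive (sym y′≈)) ,
        ≤-trans (≤-reflexive x≈) (∧ˡ ≤-refl) ,
        ≤-trans (≤-reflexive y≈) (∨-mono ≤-refl (∧ʳ ≤-refl)) ,
        ≤-trans (∧-greatest (∧ʳ ≤-refl) (∧ˡ (∨ˡ ≤-refl))) (≤-reflexive (sym x′≈))

      -- Under the first two hypotheses the sum in `↗` collapses to `x` and the product to `y′`.
      ↗⁺ : ∀ {x x′ y y′} → ⟦ x′ ⟧ρ ≤ ⟦ x ⟧ρ → ⟦ y′ ⟧ρ ≤ ⟦ y ⟧ρ →
           ⟦ x′ ⟧ρ ≤ ⟦ y′ ⟧ρ → ⟦ x ⟧ρ ≤ ⟦ y ⟧ρ → ⟦ y ⟧ρ ≤ ⟦ x ⟧ρ ∨ ⟦ y′ ⟧ρ → ⟦ x ⟧ρ ∧ ⟦ y′ ⟧ρ ≤ ⟦ x′ ⟧ρ →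
           All Holds ((x ∷ x′ ∷ []) ↗ (y ∷ y′ ∷ []))
      ↗⁺ x′≤x y′≤y x′≤y′ x≤y y≤ xy′≤x′ =
        antisym (≤-trans y≤ (∨-mono ≤-refl (∧-greatest y′≤y ≤-refl))) (∨-least x≤y (∧ˡ ≤-refl)) ∷
        antisym (∨ʳ (∧-greatest y′≤y ≤-refl)) (∨-least x′≤y′ (∧ʳ ≤-refl)) ∷
        antisym (∧-greatest x≤y (∨ˡ ≤-refl)) (∧ʳ (∨-least ≤-refl x′≤x)) ∷
        antisym (∧-greatest x′≤y′ (∨ʳ ≤-refl))
                (≤-trans (∧-greatest (∧ʳ (∨-least ≤-refl x′≤x)) (∧ˡ ≤-refl)) xy′≤x′) ∷ []

      ⨆-upper : ∀ t ts → All (λ s → ⟦ s ⟧ρ ≤ ⟦ ⨆ t ts ⟧ρ) ts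
      ⨆-upper t []       = []
      ⨆-upper t (s ∷ ts) = ∨ʳ ≤-refl ∷ All.map ∨ˡ (⨆-upper t ts)

      ⨆-least : ∀ {t ts r} → ⟦ t ⟧ρ ≤ r → All (λ s → ⟦ s ⟧ρ ≤ r) ts → ⟦ ⨆ t ts ⟧ρ ≤ r
      ⨆-least t≤r []           = t≤r
      ⨆-least t≤r (s≤r ∷ ts≤r) = ∨-least (⨆-least t≤r ts≤r) s≤r

  module _ {m : ℕ} (ρ : GenΩ (suc m) → Carrier) where
    open Evaluation ρ
    private
      M = fromAssignment ρ
      f = floors (base M)

      gens : Fin (suc m) → List (Term (GenΩ (suc m)))
      gens k = var (a⊥ k) ∷ var (a₁ k) ∷ var (a₂ k) ∷ var (c₁₂ k) ∷ []

    gensΔ≤ : ∀ {r} → IsTower f → height f ≤ r → All (λ s → ⟦ s ⟧ρ ≤ r) gensΔ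
    gensΔ≤ {r} I h≤r = concatMap⁺ {n = suc m} λ i →
      ≤r i (λ F → ≤-trans (o≤a F) (∨ˡ ≤-refl)) ∷ ≤r i (λ _ → ∨ˡ ≤-refl) ∷ ≤r i (λ _ → ∨ʳ ≤-refl) ∷ ≤r i d≤a∨b ∷ []
      where
        ≤r : ∀ {x} i → (IsFrame (f i) → x ≤ top (f i)) → x ≤ r
        ≤r i x≤ = ≤-trans (x≤ (frame I i)) (≤-trans (top≤height I i) h≤r)

    height≤ : ∀ {r} → All (λ s → ⟦ s ⟧ρ ≤ r) gensΔ → height f ≤ r
    height≤ ps with _ ∷ a≤r ∷ b≤r ∷ _ ← concatMap⁻ {n = suc m} {f = gens} ps (fromℕ m) = ∨-least a≤r b≤r

    o≤height : IsTower f → o (f zero) ≤ height f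
    o≤height I = ≤-trans (o≤a (frame I zero)) (base≤height I)

    -- Every entry of a floor lies below its top, and the tops increase along the tower, so the last
    -- top dominates all generators.
    ΣΔ≈height : IsTower f → ⟦ ⨆ (var (a⊥ zero)) gensΔ ⟧ρ ≈ height f
    ΣΔ≈height I = antisym (⨆-least (o≤height I) (gensΔ≤ I ≤-refl)) (height≤ (⨆-upper _ gensΔ))

    -- Besides `e`, only `k` is new, and it is below the join of `e` with the first `a`.
    ΣΔ3≈height₃ : IsTower₃ (base M) → ⟦ ⨆ (var (a⊥ zero)) gensΔ3 ⟧ρ ≈ height₃ (base M)
    ΣΔ3≈height₃ I = antisym
      (⨆-least (∨ˡ (o≤height (floors-isTower I)))
        (++⁺ (gensΔ≤ (floors-isTower I) (∨ˡ ≤-refl)) (∨ʳ ≤-refl ∷ k≤height₃ I ∷ [])))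
      (let ps , qs = ++⁻ gensΔ (⨆-upper (var (a⊥ zero)) gensΔ3) in ∨-least (height≤ ps) (All.head qs))

    model⇒tower : IsModel L (Δ m) ρ → IsTower f
    model⇒tower ps = record
      { frame = frames
      ; link  = λ i →
          let b≤o′ , top≤a′ , a≤ , top∧o≤ = ↗⁻ (allFin⁻ {n = 0} (map⁻ (map⁻ (concat⁻ (proj₂ split)))) i)
          in isLinked b≤o′ top≤a′ a≤ top∧o≤
      }
      where
        frameRelations : Fin (suc m) → Presentation (GenΩ (suc m))
        frameRelations k = 2-frame (var (a⊥ k)) (var (a₁ k)) (var (a₂ k)) (var (c₁₂ k))
        split = ++⁻ (concatMap frameRelations (allFin {n = 0} (suc m))) ps
        frames : ∀ i → IsFrame (f i)
        frames i = 2-frame⁻ (concatMap⁻ {n = 0} {f = frameRelations} (proj₁ split) i)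

    tower⇒model : IsTower f → IsModel L (Δ m) ρ
    tower⇒model I = ++⁺ (concatMap⁺ {n = 0} λ i → 2-frame⁺ (frame I i))
      (concat⁺ (map⁺ (map⁺ (allFin⁺ {n = 0} λ i → let K = link I i in
        ↗⁺ (∨ʳ ≤-refl) (o≤a (frame I (suc i))) (b≤o K) (top≤a K) (a≤top∨o K) (top∧o≤b K)))))

    model⇒tower₃ : IsModel L (Δ3 m) ρ → IsTower₃ (base M)
    model⇒tower₃ ps with qs , _ ∷ Σe≈o ∷ rs ← ++⁻ (Δ m) ps =
      isTower₃ I (≤-trans (∧-mono (≤-reflexive (sym (ΣΔ≈height I))) ≤-refl) (≤-reflexive Σe≈o)) (2-frame⁻ rs)
      where I = model⇒tower qs

    tower₃⇒model : IsTower₃ (base M) → IsModel L (Δ3 m) ρ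
    tower₃⇒model (isTower₃ I Te≤o F) = ++⁺ (tower⇒model I)
      (antisym (∧-greatest ≤-refl (o≤b F)) (∧ˡ ≤-refl) ∷
       antisym (≤-trans (∧-mono (≤-reflexive (ΣΔ≈height I)) ≤-refl) Te≤o)
               (∧-greatest (≤-trans (o≤height I) (≤-reflexive (sym (ΣΔ≈height I)))) (o≤b F)) ∷
       2-frame⁺ F)

    model⇒tower₄ : IsModel L (Ω m) ρ → IsTower₄ M
    model⇒tower₄ ps with qs , _ ∷ Σg≈o ∷ rs ← ++⁻ (Δ3 m) ps =
      isTower₄ I (≤-trans (∧-mono (≤-reflexive (sym (ΣΔ3≈height₃ I))) ≤-refl) (≤-reflexive Σg≈o)) (2-frame⁻ rs)
      where I = model⇒tower₃ qs

    tower₄⇒model : IsTower₄ M → IsModel L (Ω m) ρ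
    tower₄⇒model (isTower₄ I Tg≤o F) = ++⁺ (tower₃⇒model I)
      (antisym (∧-greatest ≤-refl (o≤b F)) (∧ˡ ≤-refl) ∷
       antisym (≤-trans (∧-mono (≤-reflexive (ΣΔ3≈height₃ I)) ≤-refl) Tg≤o)
               (∧-greatest (≤-trans (o≤height₃ I) (≤-reflexive (sym (ΣΔ3≈height₃ I)))) (o≤b F)) ∷
       2-frame⁺ F)

-- Terms and presented modular lattices.

⟦⟧-subst : ∀ {V W : Set} (L : ModularLattice c ℓ) (t : Term V) {σ : V → Term W} {ρ : W → ModularLattice.Carrier L} →
           ⟦ L ⟧ (t [ σ ]) ρ ≡ ⟦ L ⟧ t (λ v → ⟦ L ⟧ (σ v) ρ)
⟦⟧-subst L (var v) = ≡-refl
⟦⟧-subst L (s ⊕ t) = cong₂ (ModularLattice._∨_ L) (⟦⟧-subst L s) (⟦⟧-subst L t)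
⟦⟧-subst L (s · t) = cong₂ (ModularLattice._∧_ L) (⟦⟧-subst L s) (⟦⟧-subst L t)

module _ (L : ModularLattice c ℓ) where
  open ModularLattice L

  ⟦⟧-cong : ∀ {V : Set} (t : Term V) {ρ ρ′ : V → Carrier} → (∀ v → ρ v ≈ ρ′ v) → ⟦ L ⟧ t ρ ≈ ⟦ L ⟧ t ρ′
  ⟦⟧-cong (var v) E = E v
  ⟦⟧-cong (s ⊕ t) E = ∨-cong (⟦⟧-cong s E) (⟦⟧-cong t E)
  ⟦⟧-cong (s · t) E = ∧-cong (⟦⟧-cong s E) (⟦⟧-cong t E)

module Presented {V : Set} (Π : Presentation V) where

  infix 4 _≃_

  -- The least congruence that contains `Π` and has a modular lattice as quotient. For empty `Π` the
  -- quotient is the free modular lattice.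
  data _≃_ : Term V → Term V → Set where
    relation : ∀ {r} → r ∈ Π → proj₁ r ≃ proj₂ r
    ≃-refl   : ∀ {s} → s ≃ s
    ≃-sym    : ∀ {s t} → s ≃ t → t ≃ s
    ≃-trans  : ∀ {s t u} → s ≃ t → t ≃ u → s ≃ u
    ⊕-comm   : ∀ s t → s ⊕ t ≃ t ⊕ s
    ⊕-assoc  : ∀ s t u → s ⊕ t ⊕ u ≃ s ⊕ (t ⊕ u)
    ⊕-cong   : ∀ {s s′ t t′} → s ≃ s′ → t ≃ t′ → s ⊕ t ≃ s′ ⊕ t′
    ·-comm   : ∀ s t → s · t ≃ t · s
    ·-assoc  : ∀ s t u → s · t · u ≃ s · (t · u)
    ·-cong   : ∀ {s s′ t t′} → s ≃ s′ → t ≃ t′ → s · t ≃ s′ · t′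
    ⊕-absorb : ∀ s t → s ⊕ s · t ≃ s
    ·-absorb : ∀ s t → s · (s ⊕ t) ≃ s
    ≃-modular : ∀ s t u → s ≃ s · u → (s ⊕ t) · u ≃ s ⊕ t · u

  presented : ModularLattice 0ℓ 0ℓ
  presented = record
    { lattice = record
      { Carrier = Term V
      ; _≈_ = _≃_
      ; _∨_ = _⊕_
      ; _∧_ = _·_
      ; isLattice = record
        { isEquivalence = record { refl = ≃-refl ; sym = ≃-sym ; trans = ≃-trans }
        ; ∨-comm = ⊕-comm
        ; ∨-assoc = ⊕-assoc
        ; ∨-cong = ⊕-cong
        ; ∧-comm = ·-comm
        ; ∧-assoc = ·-assoc
        ; ∧-cong = ·-cong
        ; absorptive = ⊕-absorb , ·-absorb
        }
      }
    ; modular = ≃-modular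
    }

  module _ (L : ModularLattice c ℓ) {ρ : V → ModularLattice.Carrier L} (ρ⊨Π : IsModel L Π ρ) where
    open ModularLattice L

    sound : ∀ {s t} → s ≃ t → ⟦ L ⟧ s ρ ≈ ⟦ L ⟧ t ρ
    sound (relation r∈Π)     = All.lookup ρ⊨Π r∈Π
    sound ≃-refl             = refl
    sound (≃-sym p)          = sym (sound p)
    sound (≃-trans p q)      = trans (sound p) (sound q)
    sound (⊕-comm s t)       = ∨-comm _ _
    sound (⊕-assoc s t u)    = ∨-assoc _ _ _
    sound (⊕-cong p q)       = ∨-cong (sound p) (sound q)
    sound (·-comm s t)       = ∧-comm _ _
    sound (·-assoc s t u)    = ∧-assoc _ _ _
    sound (·-cong p q)       = ∧-cong (sound p) (sound q)
    sound (⊕-absorb s t)     = ∨-absorbs-∧ _ _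
    sound (·-absorb s t)     = ∧-absorbs-∨ _ _
    sound (≃-modular s t u p) = modular _ _ _ (sound p)

  ⟦⟧-presented : ∀ {W : Set} (t : Term W) {σ : W → Term V} → ⟦ presented ⟧ t σ ≡ t [ σ ]
  ⟦⟧-presented (var v) = ≡-refl
  ⟦⟧-presented (s ⊕ t) = cong₂ _⊕_ (⟦⟧-presented s) (⟦⟧-presented t)
  ⟦⟧-presented (s · t) = cong₂ _·_ (⟦⟧-presented s) (⟦⟧-presented t)

  []-var : ∀ (t : Term V) → t [ var ] ≡ t
  []-var (var v) = ≡-refl
  []-var (s ⊕ t) = cong₂ _⊕_ ([]-var s) ([]-var t)
  []-var (s · t) = cong₂ _·_ ([]-var s) ([]-var t)

  generic-model : IsModel presented Π var
  generic-model = All.tabulate λ {r} r∈Π →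
    subst₂ _≃_ (≡-sym (eval (proj₁ r))) (≡-sym (eval (proj₂ r))) (relation r∈Π)
    where
      eval : ∀ t → ⟦ presented ⟧ t var ≡ t
      eval t = ≡-trans (⟦⟧-presented t) ([]-var t)

-- Projectivity.

module _ {V : Set} (Π : Presentation V) (σ : V → Term V) where
  private
    module Free = Presented ([] {A = Relation V})
    module Generic = Presented Π

  -- By soundness an equality in the free modular lattice holds under all assignments, and one in
  -- the lattice presented by `Π` holds in all models. So each half of projectivity needs to be
  -- checked in one lattice only.
  retraction⇒projective : IsModel Free.presented Π σ → (∀ v → σ v Generic.≃ var v) → Projective Π
  retraction⇒projective σ⊨Π σ≃var = record
    { t = σ
    ; model = λ L ρ → All.map (λ {r} p →
        subst₂ (ModularLattice._≈_ L) (eval L (proj₁ r)) (eval L (proj₂ r)) (Free.sound L {ρ} [] p)) σ⊨Π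
    ; retract = λ L ρ ρ⊨Π v → Generic.sound L ρ⊨Π (σ≃var v)
    }
    where
      eval : ∀ {c ℓ} (L : ModularLattice c ℓ) {ρ : V → ModularLattice.Carrier L} (t : Term V) →
             ⟦ L ⟧ (⟦ Free.presented ⟧ t σ) ρ ≡ ⟦ L ⟧ t (λ v → ⟦ L ⟧ (σ v) ρ)
      eval L {ρ} t = ≡-trans
        (cong (λ s → ⟦ L ⟧ s ρ) (Free.⟦⟧-presented t)) (⟦⟧-subst L t)

Ω-projective : ∀ m → Projective (Ω m)
-- `free` and `generic` share their carrier and operations and differ only in equality, so running
-- the construction in either one yields these same terms.
Ω-projective m = retraction⇒projective (Ω m) (Construction.retraction terms var)
  (Relations.tower₄⇒model free _ (Modular.retract₄-isTower₄ free _))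
  (Modular.assignment-≈ generic
    (Modular.retract₄-id generic (Relations.model⇒tower₄ generic var (Presented.generic-model (Ω m)))))
  where
    terms : Ops (Term (GenΩ (suc m)))
    terms = record { _∨_ = _⊕_ ; _∧_ = _·_ }
    free generic : ModularLattice 0ℓ 0ℓ
    free    = Presented.presented []
    generic = Presented.presented (Ω m)

-- Reducing the number of generators.

record GeneratedBy {V : Set} (Π : Presentation V) {n : ℕ} (u : Fin n → Term V) : Setω where
  field
    v       : V → Term (Fin n)
    recover : ∀ {c ℓ} (L : ModularLattice c ℓ) (ρ : V → ModularLattice.Carrier L) →
              IsModel L Π ρ → _≋_ L (_⟪_⟫ {L = L} v (_⟪_⟫ {L = L} u ρ)) ρ

-- `Ψ` consists of the relations of `Π` rewritten through `v`, and of relations saying that each new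
-- generator is recovered from its own definition. The latter give `uv-id`.
generatedBy⇒equivalent : ∀ {V : Set} {Π : Presentation V} {n} {u : Fin n → Term V} →
                         GeneratedBy Π u → EquivalentToPresentationWith Π n
generatedBy⇒equivalent {V} {Π} {n} {u} G = record
  { Ψ = Ψ
  ; equiv = record
    { u = u
    ; v = v
    ; u-model = u-model
    ; vu-id = recover
    ; v-model = λ L ρ ρ⊨Ψ → All.map
        (λ {r} p → subst₂ (ModularLattice._≈_ L) (⟦⟧-subst L (proj₁ r)) (⟦⟧-subst L (proj₂ r)) p)
        (map⁻ (proj₁ (++⁻ (map translate Π) ρ⊨Ψ)))
    ; uv-id = λ L ρ ρ⊨Ψ j → subst (λ x → ModularLattice._≈_ L x (ρ j)) (⟦⟧-subst L (u j))
        (allFin⁻ {n = 0} (map⁻ (proj₂ (++⁻ (map translate Π) ρ⊨Ψ))) j)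
    }
  }
  where
    open GeneratedBy G
    translate : Relation V → Relation (Fin n)
    translate r = proj₁ r [ v ] , proj₂ r [ v ]
    Ψ : Presentation (Fin n)
    Ψ = map translate Π ++ map (λ j → u j [ v ] , var j) (allFin {n = 0} n)
    u-model : ∀ {c ℓ} (L : ModularLattice c ℓ) (ρ : V → ModularLattice.Carrier L) →
              IsModel L Π ρ → IsModel L Ψ (_⟪_⟫ {L = L} u ρ)
    u-model L ρ ρ⊨Π = ++⁺
      (map⁺ (All.map (λ {r} p → trans (eval (proj₁ r)) (trans p (sym (eval (proj₂ r))))) ρ⊨Π))
      (map⁺ (allFin⁺ {n = 0} (λ j → eval (u j))))
      where
        open ModularLattice L
        eval : ∀ t → ⟦ L ⟧ (t [ v ]) (_⟪_⟫ {L = L} u ρ) ≈ ⟦ L ⟧ t ρ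
        eval t = trans (reflexive (⟦⟧-subst L t)) (⟦⟧-cong L t (recover L ρ ρ⊨Π))

module _ (m : ℕ) where

  otherGenerators : Fin 6 → Term (GenΩ (suc m))
  otherGenerators 0F = var (a₁ zero)
  otherGenerators 1F = var (a₂ (fromℕ m))
  otherGenerators 2F = var a₃
  otherGenerators 3F = var c₁₃
  otherGenerators 4F = var a₄′
  otherGenerators 5F = var c₁₄′

  generators : Fin (suc m + 6) → Term (GenΩ (suc m))
  generators = [ var ∘ c₁₂ , otherGenerators ]′ ∘ splitAt (suc m)

  private
    C : Fin (suc m) → Term (Fin (suc m + 6))
    C i = var (i ↑ˡ 6)

    S : Fin 6 → Term (Fin (suc m + 6))
    S j = var (suc m ↑ʳ j)

    successor : Fin (suc m) → Term (Fin (suc m + 6))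
    successor = snoc (C ∘ suc) (S 1F)

    v : GenΩ (suc m) → Term (Fin (suc m + 6))
    v (a⊥ i)  = C i · successor i
    v (a₁ i)  = S 0F ⊕ C i · successor i
    v (a₂ i)  = successor i · (S 0F ⊕ C i)
    v (c₁₂ i) = C i
    v a₃      = S 2F
    v c₁₃     = S 3F
    v a₄′     = S 4F
    v c₁₄′    = S 5F

    module _ {c ℓ : Level} (L : ModularLattice c ℓ) (ρ : GenΩ (suc m) → ModularLattice.Carrier L)
             (ρ⊨Ω : IsModel L (Ω m) ρ) where
      open Modular L
      open Relations L using (model⇒tower₄)

      τ : Fin (suc m + 6) → Carrier
      τ = _⟪_⟫ {L = L} generators ρ

      f : Floors m
      f = floors (base (fromAssignment ρ))

      I : IsTower f
      I = floors-isTower (IsTower₄.base-isTower₃ (model⇒tower₄ ρ ρ⊨Ω))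

      C-≡ : ∀ i → τ (i ↑ˡ 6) ≡ ρ (c₁₂ i)
      C-≡ i = cong (λ s → ⟦ L ⟧ ([ var ∘ c₁₂ , otherGenerators ]′ s) ρ) (splitAt-↑ˡ (suc m) i 6)

      S-≡ : ∀ j → τ (suc m ↑ʳ j) ≡ ⟦ L ⟧ (otherGenerators j) ρ
      S-≡ j = cong (λ s → ⟦ L ⟧ ([ var ∘ c₁₂ , otherGenerators ]′ s) ρ) (splitAt-↑ʳ (suc m) 6 j)

      -- The common property of `c₁₂` on the next floor and, for the last floor, of `a₂` itself: on
      -- meeting with the top of the floor both give `a₂`. The recovery of `a⊥` and `a₂` uses
      -- nothing else about the successor.
      Separates : Fin (suc m) → Term (Fin (suc m + 6)) → Set ℓ
      Separates i t = b (f i) ≤ ⟦ L ⟧ t τ × top (f i) ∧ ⟦ L ⟧ t τ ≤ b (f i)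

      -- Below the last floor, the top is under the next `a`, which meets the next `c₁₂` in the next
      -- bottom; the link then brings the meet down to `b`. On the last floor the successor is `b`.
      successor-separates : ∀ i → Separates i (successor i)
      successor-separates = snoc-elim Separates
        (λ i → subst (λ y → b (f (inject₁ i)) ≤ y × top (f (inject₁ i)) ∧ y ≤ b (f (inject₁ i)))
          (≡-sym (C-≡ (suc i)))
          (≤-trans (b≤o (link I i)) (o≤d (frame I (suc i))) ,
           ≤-trans (∧-greatest (∧ˡ ≤-refl) (≤-trans (∧-mono (top≤a (link I i)) ≤-refl) (ad≤o (frame I (suc i)))))
                   (top∧o≤b (link I i))))
        (subst (λ y → b (f (fromℕ m)) ≤ y × top (f (fromℕ m)) ∧ y ≤ b (f (fromℕ m))) (≡-sym (S-≡ 1F))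
          (≤-refl , ∧ʳ ≤-refl))

      -- As `c₁₂` is below the top of its floor, its meet with the successor lies below `a₂`, hence
      -- in the bottom.
      o-recovered : ∀ i → ⟦ L ⟧ (v (a⊥ i)) τ ≈ ρ (a⊥ i)
      o-recovered i rewrite C-≡ i = let b≤y , top∧y≤b = successor-separates i ; F = frame I i in
        antisym (≤-trans (∧-greatest (≤-trans (∧-mono (d≤a∨b F) ≤-refl) top∧y≤b) (∧ˡ ≤-refl)) (bd≤o F))
                (∧-greatest (o≤d F) (≤-trans (o≤b F) b≤y))

      v-recovers : ∀ x → ⟦ L ⟧ (v x) τ ≈ ρ x
      v-recovers (a⊥ i) = o-recovered i
      v-recovers (a₁ i) = trans (∨-cong (reflexive (S-≡ 0F)) (o-recovered i))
        (antisym (∨-least (base-a≤a B) (o≤a (frame I i))) (a≤base∨o B))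
        where B = isTower-above I i
      -- The join of the first `a₁` with `c₁₂` is below the top of floor `i`. It also contains `a₂`,
      -- because `a₁` on floor `i` is the first `a₁` joined with a bottom that is below `c₁₂`.
      v-recovers (a₂ i) rewrite C-≡ i | S-≡ 0F = let b≤y , top∧y≤b = successor-separates i ; F = frame I i in
        antisym (≤-trans (∧-greatest (∧ʳ (∨-least (∨ˡ (base-a≤a B)) (d≤a∨b F))) (∧ˡ ≤-refl)) top∧y≤b)
                (∧-greatest b≤y (≤-trans (b≤a∨d F) (∨-least
                  (≤-trans (a≤base∨o B) (∨-mono ≤-refl (o≤d F))) (∨ʳ ≤-refl))))
        where B = isTower-above I i
      v-recovers (c₁₂ i) = reflexive (C-≡ i)
      v-recovers a₃      = reflexive (S-≡ 2F)
      v-recovers c₁₃     = reflexive (S-≡ 3F)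
      v-recovers a₄′     = reflexive (S-≡ 4F)
      v-recovers c₁₄′    = reflexive (S-≡ 5F)

  Ω-generatedBy : GeneratedBy (Ω m) generators
  Ω-generatedBy = record { v = v ; recover = v-recovers }

theorem3p9 : (m : ℕ) → Projective (Ω m) ×ω EquivalentToPresentationWith (Ω m) (suc m + 6)
theorem3p9 m = Ω-projective m ,ω generatedBy⇒equivalent (Ω-generatedBy m)
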